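{- Let $r\ge1$ and let $a_1,\dots,a_r$ be indeterminates. For every $j\in[0,r+1]$, every entry of the matrix $P_j(\{a\})$ defined below is a polynomial in $a_1,\dots,a_r$. Consequently the limit $P_j:=\lim_{a_1,\dots,a_r\to0}P_j(\{a\})$ is well defined.
   Context: For $i\in[1,r]$ and nonzero $a,b,c$, let $U_i(a,b,c)$ (resp. $V_i(a,b,c)$) be the $(r+1)\times(r+1)$ matrix equal to the identity except that its $2\times2$ block in rows and columns $i,i+1$ is $\begin{pmatrix}1&0\\ c/b& a/b\end{pmatrix}$ (resp. $\begin{pmatrix}b/c& a/c\\ 0&1\end{pmatrix}$). Define the array $(a_{i,-j})_{i,j\in[0,r+1]}$ of rational functions in $a_1,\dots,a_r$ by $a_{i,0}=1$ ($i\in[0,r+1]$), $a_{0,-j}=a_{r+1,-j}=1$ ($j\in[0,r+1]$), $a_{i,-1}=a_i$ ($i\in[1,r]$), and $a_{i-1,-j}a_{i+1,-j}+a_{i,-j-1}a_{i,-j+1}=0$ for $i,j\in[1,r]$ (this determines all entries recursively, and they are nonzero). For $i\in[1,r]$ and $k\in[-r,0]$ set $N_{i,k}(\{a\})=U_i(a_{i,k-1},a_{i,k},a_{i+1,k-1})$ if $i+k$ is odd and $N_{i,k}(\{a\})=V_i(a_{i-1,k},a_{i,k-1},a_{i,k})$ if $i+k$ is even. For $j\in[0,r+1]$ define $P_j(\{a\})=\prod_{k=-j+1}^{0}\big(N_{1,k}(\{a\})N_{2,k}(\{a\})\cdots N_{r,k}(\{a\})\big)$, the factors being ordered left to right by increasing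 $k$ (and $P_0(\{a\})$ is the identity). -}

module Defs where

open import Data.Nat as ℕ using (ℕ; zero; suc; _+_; _∸_; _≡ᵇ_; _<ᵇ_)
open import Data.Bool using (Bool; true; false; if_then_else_; _∨_; _∧_)
open import Data.Fin as Fin using (Fin; toℕ)
open import Data.List using (List; foldr; map; upTo)
open import Data.Product using (_×_; _,_; proj₁; proj₂; Σ)
open import Data.Rational as ℚ using (ℚ; 0ℚ; 1ℚ)
open import Function using (_∘_)
open import Relation.Nullary using (¬_; does)
open import Relation.Binary.PropositionalEquality using (_≡_)
open import Tactic.RingSolver.Core.Polynomial.Parameters using (RawCoeff)

-- The polynomial ring ℚ[a₁,…,a_r], in the standard library's canonical
-- (sparse Horner) normal form.  Structural equality of normal forms is
-- equality of polynomials.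

ℚcoeff : RawCoeff _ _
ℚcoeff = record { rawRing = ℚ.+-*-rawRing ; isZero = λ x → does (x ℚ.≟ 0ℚ) }

open import Tactic.RingSolver.Core.Polynomial.Base ℚcoeff public
  using (Poly; Zero; _⊞_; _⊠_; ⊟_; κ; ι)

-- a Fin (suc n) from a natural number (clamped; only used in range)
clampFin : (n k : ℕ) → Fin (suc n)
clampFin n zero = Fin.zero
clampFin zero (suc k) = Fin.zero
clampFin (suc n) (suc k) = Fin.suc (clampFin n k)

-- the indeterminate a_i (1-based, i ∈ [1,r]) in ℚ[a₁,…,a_r]
Var : (r : ℕ) → ℕ → Poly r
Var zero i = κ 1ℚ
Var (suc r) i = ι (clampFin r (i ∸ 1))

-- Rational functions ℚ(a₁,…,a_r) as formal fractions num/den.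

Frac : ℕ → Set
Frac r = Poly r × Poly r

module _ {r : ℕ} where
  0F 1F : Frac r
  0F = κ 0ℚ , κ 1ℚ
  1F = κ 1ℚ , κ 1ℚ

  infixl 6 _+F_
  infixl 7 _*F_ _/F_
  _+F_ _*F_ _/F_ : Frac r → Frac r → Frac r
  (a , b) +F (c , d) = (a ⊠ d) ⊞ (c ⊠ b) , b ⊠ d
  (a , b) *F (c , d) = a ⊠ c , b ⊠ d
  (a , b) /F (c , d) = a ⊠ d , b ⊠ c

  -F_ : Frac r → Frac r
  -F (a , b) = ⊟ a , b

-- A formal fraction n/d is a genuine rational function (d ≠ 0) which
-- is a polynomial: n/d = f for some f ∈ ℚ[a₁,…,a_r].
IsPolynomial : (r : ℕ) → Frac r → Set
IsPolynomial r (n , d) = (¬ Zero d) × Σ (Poly r) (λ f → n ≡ f ⊠ d)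

-- The array a_{i,-j}:  A r i j = a_{i,-j}.

edge : ℕ → ℕ → Bool
edge r i = (i ≡ᵇ 0) ∨ (r <ᵇ i)

row0 row1 : (r : ℕ) → ℕ → Frac r
row0 r i = 1F
row1 r i = if edge r i then 1F else (Var r i , κ 1ℚ)

step : (r : ℕ) → (ℕ → Frac r) → (ℕ → Frac r) → ℕ → Frac r
step r prev cur i =
  if edge r i then 1F else (-F (cur (i ∸ 1) *F cur (suc i))) /F prev i

rows : (r j : ℕ) → (ℕ → Frac r) × (ℕ → Frac r)
rows r zero = row0 r , row1 r
rows r (suc j) = proj₂ (rows r j) , step r (proj₁ (rows r j)) (proj₂ (rows r j))

A : (r i j : ℕ) → Frac r
A r i j = proj₁ (rows r j) i

-- (r+1)×(r+1) matrices over ℚ(a); row/column p ∈ Fin (suc r) is the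
-- paper's index toℕ p + 1 ∈ [1, r+1].

Mat : ℕ → Set
Mat r = Fin (suc r) → Fin (suc r) → Frac r

Id : (r : ℕ) → Mat r
Id r p q = if toℕ p ≡ᵇ toℕ q then 1F else 0F

sumFin : ∀ {r} n → (Fin n → Frac r) → Frac r
sumFin zero f = 0F
sumFin (suc n) f = f Fin.zero +F sumFin n (f ∘ Fin.suc)

infixl 7 _·_
_·_ : ∀ {r} → Mat r → Mat r → Mat r
_·_ {r} M N p q = sumFin (suc r) (λ k → M p k *F N k q)

block : (r i : ℕ) → Frac r → Frac r → Frac r → Frac r → Mat r
block r i e11 e12 e21 e22 p q =
  let rp = suc (toℕ p) ; rq = suc (toℕ q) in
  if (rp ≡ᵇ i) ∧ (rq ≡ᵇ i) then e11 else
  if (rp ≡ᵇ i) ∧ (rq ≡ᵇ suc i) then e12 else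
  if (rp ≡ᵇ suc i) ∧ (rq ≡ᵇ i) then e21 else
  if (rp ≡ᵇ suc i) ∧ (rq ≡ᵇ suc i) then e22 else
  Id r p q

U V : (r i : ℕ) → Frac r → Frac r → Frac r → Mat r
U r i a b c = block r i 1F 0F (c /F b) (a /F b)
V r i a b c = block r i (b /F c) (a /F c) 0F 1F

isOdd : ℕ → Bool
isOdd zero = false
isOdd (suc n) with isOdd n
... | true = false
... | false = true

-- N r i m = N_{i,k}({a}) with k = -m
N : (r i m : ℕ) → Mat r
N r i m =
  if isOdd (i + m)
  then U r i (A r i (suc m)) (A r i m) (A r (suc i) (suc m))
  else V r i (A r (i ∸ 1) m) (A r i (suc m)) (A r i m)

RowProd : (r m : ℕ) → Mat r
RowProd r m = foldr (λ i M → N r i m · M) (Id r) (map suc (upTo r))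

-- P_j({a}) = ∏_{k=-j+1}^{0} (N_{1,k}⋯N_{r,k}), increasing k left to right
P : (r j : ℕ) → Mat r
P r zero = Id r
P r (suc j) = RowProd r j · P r j

{-# OPTIONS --safe #-}
module Submission where

-- A normal form is determined by its values at the points of ℚ^r with nonzero coordinates, so
-- it suffices to express the entries of P_j at such points by polynomials.  Write B p t = a_{p,-t},
-- let x t p be the entry in row p of a fixed column of P_t, and let e = x 0.  Passing from P_t to
-- P_{t+1} changes only the rows p with p + t even, by a recursion in the rows p - 1, p and p + 1.
-- Since B p (t+1) · B p (t-1) = - B (p-1) t · B (p+1) t, the ratio B (p+1) (t+1) / B p t depends, up
-- to sign, only on p + t, and the recursion factors into first-order laws along the diagonals: for
-- k = p + t + 1 ≤ r + 1,
--   x (t+1) (p+1) = ± a_k · x t p + B p (t+1) · (a_k · e_k + e_{k+1}).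
-- This gives polynomials for p + t ≤ r + 2.  Further down the ratios are inverses of the a_k, but
-- the reversed law expresses x t p polynomially through x (t+1) (p+1), and the row t = r + 1,
-- which is ± e read backwards, starts a descending induction.

open import Defs
open import Algebra.Bundles using (CommutativeRing)
open import Data.Bool using (T; true; false; not; if_then_else_; _∧_)
open import Data.Bool.Properties using (not-injective; not-involutive)
open import Data.Empty using (⊥; ⊥-elim; ⊥-elim-irr)
open import Data.Fin as Fin using (Fin; toℕ)
import Data.Fin.Properties as Fin
open import Data.List using (List; []; _∷_; length; map; foldr; applyUpTo; upTo)
open import Data.List.Kleene using (_&_; ∹_; []) renaming (_+ to _⁺; _* to _⋆)
open import Data.List.Relation.Unary.All using ([]; _∷_) renaming (All to ListAll)
open import Data.Maybe using (nothing)
open import Data.Nat as ℕ using (ℕ; zero; suc; _≤_; _<_; s≤s; z≤n; ≤′-refl; ≤′-step; _≡ᵇ_; _<ᵇ_; _∸_)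
import Data.Nat.Properties as ℕ
open import Data.Product using (_×_; _,_; proj₁; proj₂; Σ)
open import Data.Rational as ℚ using (ℚ; 0ℚ; 1ℚ; _+_; _*_; -_; _-_)
import Data.Rational.Properties as ℚ
open import Data.Rational.Solver using (module +-*-Solver)
open import Data.Sum using (_⊎_; inj₁; inj₂)
open import Data.Vec using (Vec; []; _∷_; replicate)
open import Data.Vec.Membership.Propositional.Properties using (∈-lookup)
open import Data.Vec.Relation.Unary.All as All using (All; []; _∷_)
open import Function using (_∘_)
open import Relation.Binary.PropositionalEquality
open import Relation.Nullary using (¬_; Dec; yes; no; does; contradiction)
open import Tactic.RingSolver.Core.AlmostCommutativeRing using (fromCommutativeRing; -raw-almostCommutative⟶)
open import Tactic.RingSolver.Core.Polynomial.Base ℚcoeff using (Coeff; Κ; ⅀; _⊐_; _Δ_; _≠0; Normalised)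
open import Tactic.RingSolver.Core.Polynomial.Parameters using (Homomorphism)
open import Algebra.Properties.Group ℚ.+-0-group using (x∙y⁻¹≈ε⇒x≈y)
open import Algebra.Properties.Semiring.Sum (CommutativeRing.semiring ℚ.+-*-commutativeRing)
  using (sum; sum-cong-≗; ∑-comm; ∑-distrib-+; *-distribˡ-sum; *-distribʳ-sum)
open +-*-Solver using (solve; _:+_; _:*_; :-_; _:-_; _:=_; con)

-- The obstacle is division. The array is built from quotients and formal fractions never cancel, so
-- the numerators and denominators of `P r j` do not reveal a polynomial. At a point with nonzero
-- coordinates all `B p t` are nonzero, so cancellation is legitimate there, and a polynomial found
-- by other means can be compared with the fraction by values. The parity comes from the pattern of
-- the factors: V_i rewrites row i and U_i rewrites row i + 1, so row p is touched by N_{p-1} and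
-- N_p at most. Either these are U_{p-1} and V_p, which both rewrite row p, or V_{p-1} and U_p,
-- which leave it alone. The neighbours of a rewritten row therefore stay fixed in that step, which
-- gives a three-term recursion in old rows only. Each first-order law is solved for the entry whose
-- coefficient is a polynomial; this forces the change of direction near the middle. The
-- mirror-image laws along the antidiagonals supply the boundary data for the reversed direction:
-- the last row and the level t = r + 1.

T-isZero : ∀ x → T (does (x ℚ.≟ 0ℚ)) → 0ℚ ≡ x
T-isZero x z with x ℚ.≟ 0ℚ
... | yes x≡0 = sym x≡0

evaluation : Homomorphism _ _ _ _
evaluation = record
  { from = ℚcoeff
  ; to = ℚ-ring
  ; morphism = -raw-almostCommutative⟶ ℚ-ring
  ; Zero-C⟶Zero-R = T-isZero
  }
  where ℚ-ring = fromCommutativeRing ℚ.+-*-commutativeRing (λ _ → nothing)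

open import Tactic.RingSolver.Core.Polynomial.Semantics evaluation using (⟦_⟧; ⅀⟦_⟧; _*⟨_⟩^_)
open import Tactic.RingSolver.Core.Polynomial.Homomorphism evaluation
  using (⊞-hom; ⊠-hom; ⊟-hom; ι-hom)
open import Tactic.RingSolver.Core.Polynomial.Homomorphism.Lemmas evaluation using (zero-hom; pow-opt; pow-suc)

open import Algebra.Properties.Semiring.Exp.TCOptimised (Homomorphism.semiring evaluation) using (_^_)

*-cancelʳ-≢0 : ∀ {x y z} → z ≢ 0ℚ → x * z ≡ y * z → x ≡ y
*-cancelʳ-≢0 {x} {y} {z} z≢0 xz≡yz = begin
  x                     ≡⟨ unfold x ⟩
  x * z * (ℚ.1/ z)      ≡⟨ cong (_* (ℚ.1/ z)) xz≡yz ⟩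
  y * z * (ℚ.1/ z)      ≡⟨ unfold y ⟨
  y                     ∎
  where
  open ≡-Reasoning
  instance
    z-nonZero : ℚ.NonZero z
    z-nonZero = ℚ.≢-nonZero z≢0
  unfold : ∀ x → x ≡ x * z * (ℚ.1/ z)
  unfold x = begin
    x                   ≡⟨ ℚ.*-identityʳ x ⟨
    x * 1ℚ              ≡⟨ cong (x *_) (ℚ.*-inverseʳ z) ⟨
    x * (z * (ℚ.1/ z))  ≡⟨ ℚ.*-assoc x z (ℚ.1/ z) ⟨
    x * z * (ℚ.1/ z)    ∎

*-≢0 : ∀ {x y} → x ≢ 0ℚ → y ≢ 0ℚ → x * y ≢ 0ℚ
*-≢0 {y = y} x≢0 y≢0 xy≡0 = x≢0 (*-cancelʳ-≢0 y≢0 (trans xy≡0 (sym (ℚ.*-zeroˡ y))))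

-- Univariate polynomials with infinitely many roots

horner : List ℚ → ℚ → ℚ
horner [] x = 0ℚ
horner (c ∷ cs) x = x * horner cs x + c

coefficient : List ℚ → ℕ → ℚ
coefficient [] k = 0ℚ
coefficient (c ∷ cs) zero = c
coefficient (c ∷ cs) (suc k) = coefficient cs k

-- Synthetic division: `quotient a cs` is the quotient of c ∷ cs by x - a, whatever the constant term c is.
quotient : ℚ → List ℚ → List ℚ
quotient a [] = []
quotient a (c ∷ cs) = horner (c ∷ cs) a ∷ quotient a cs

length-quotient : ∀ a cs → length (quotient a cs) ≡ length cs
length-quotient a [] = refl
length-quotient a (c ∷ cs) = cong suc (length-quotient a cs)

-- This is division of `c ∷ cs` by x - a with the constant term `c` subtracted from both sides; in
-- this form the induction closes.
horner-quotient : ∀ a cs x → x * horner cs x ≡ a * horner cs a + (x - a) * horner (quotient a cs) x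
horner-quotient a [] x = solve 2 (λ a x → x :* con 0ℚ := a :* con 0ℚ :+ (x :- a) :* con 0ℚ) refl a x
horner-quotient a (c ∷ cs) x = begin
  x * (x * horner cs x + c)              ≡⟨ cong (λ u → x * (u + c)) (horner-quotient a cs x) ⟩
  x * (a * h + (x - a) * q + c)          ≡⟨ solve 5 (λ a c x h q →
       x :* (a :* h :+ (x :- a) :* q :+ c) :=
       a :* (a :* h :+ c) :+ (x :- a) :* (x :* q :+ (a :* h :+ c))) refl a c x h q ⟩
  a * (a * h + c) + (x - a) * (x * q + (a * h + c)) ∎
  where
  open ≡-Reasoning
  h = horner cs a
  q = horner (quotient a cs) x

horner-zero : ∀ {cs} → ListAll (_≡ 0ℚ) cs → ∀ x → horner cs x ≡ 0ℚ
horner-zero [] x = refl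
horner-zero (refl ∷ zs) x = trans (cong (λ u → x * u + 0ℚ) (horner-zero zs x)) (trans (ℚ.+-identityʳ (x * 0ℚ)) (ℚ.*-zeroʳ x))

horner-constant : ∀ {cs} → ListAll (_≡ 0ℚ) cs → ∀ c x → horner (c ∷ cs) x ≡ c
horner-constant zs c x = trans (cong (λ u → x * u + c) (horner-zero zs x)) (trans (cong (_+ c) (ℚ.*-zeroʳ x)) (ℚ.+-identityˡ c))

-- The entries of the quotient are the values at `a` of the tails of `cs`. Once a tail is known to
-- vanish, the entry before it is just the next coefficient.
quotient-zero : ∀ a cs → ListAll (_≡ 0ℚ) (quotient a cs) → ListAll (_≡ 0ℚ) cs
quotient-zero a [] [] = []
quotient-zero a (c ∷ cs) (z ∷ zs) = trans (sym (horner-constant zs′ c a)) z ∷ zs′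
  where zs′ = quotient-zero a cs zs

fromℕ : ℕ → ℚ
fromℕ zero = 0ℚ
fromℕ (suc k) = 1ℚ + fromℕ k

fromℕ-+ : ∀ k m → fromℕ (k ℕ.+ m) ≡ fromℕ k + fromℕ m
fromℕ-+ zero m = sym (ℚ.+-identityˡ (fromℕ m))
fromℕ-+ (suc k) m = trans (cong (1ℚ +_) (fromℕ-+ k m)) (sym (ℚ.+-assoc 1ℚ (fromℕ k) (fromℕ m)))

0≤fromℕ : ∀ k → 0ℚ ℚ.≤ fromℕ k
0≤fromℕ zero = ℚ.≤-refl
0≤fromℕ (suc k) = ℚ.+-mono-≤ (ℚ.nonNegative⁻¹ 1ℚ) (0≤fromℕ k)

fromℕ-suc≢0 : ∀ k → fromℕ (suc k) ≢ 0ℚ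
fromℕ-suc≢0 k eq = ℚ.<⇒≢ (ℚ.+-mono-<-≤ (ℚ.positive⁻¹ 1ℚ) (0≤fromℕ k)) (sym eq)

-- Dividing by x - (m + 1) leaves a quotient with the roots m + 2, m + 3, ..., so `m` moves up with
-- each division. The roots start above 0 because only nonzero points are available. `n` carries the
-- recursion, as the quotient is not a sublist of `cs`.
roots⇒zero : ∀ n cs → length cs ≡ n → ∀ m → (∀ k → horner cs (fromℕ (suc k ℕ.+ m)) ≡ 0ℚ) → ListAll (_≡ 0ℚ) cs
roots⇒zero n [] _ m roots = []
roots⇒zero (suc n) (c ∷ cs) len m roots = trans (sym (horner-constant zs c a)) (roots 0) ∷ zs
  where
  a = fromℕ (suc m)
  quotient-roots : ∀ k → horner (quotient a cs) (fromℕ (suc k ℕ.+ suc m)) ≡ 0ℚ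
  quotient-roots k = *-cancelʳ-≢0 (fromℕ-suc≢0 k) (begin
    q * fromℕ (suc k)                                  ≡⟨ cong (q *_) x-a ⟨
    q * (x - a)
      ≡⟨ solve 5 (λ q x a h c → q :* (x :- a) := (a :* h :+ (x :- a) :* q :+ c) :- (a :* h :+ c))
           refl q x a (horner cs a) c ⟩
    (a * horner cs a + (x - a) * q + c) - horner (c ∷ cs) a
      ≡⟨ cong (λ u → u + c - horner (c ∷ cs) a) (horner-quotient a cs x) ⟨
    horner (c ∷ cs) x - horner (c ∷ cs) a
      ≡⟨ cong₂ _-_ (trans (cong (λ j → horner (c ∷ cs) (fromℕ j)) (ℕ.+-suc (suc k) m)) (roots (suc k))) (roots 0) ⟩
    0ℚ                                                 ≡⟨ ℚ.*-zeroˡ (fromℕ (suc k)) ⟨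
    0ℚ * fromℕ (suc k)                                 ∎)
    where
    open ≡-Reasoning
    x = fromℕ (suc k ℕ.+ suc m)
    q = horner (quotient a cs) x
    x-a : x - a ≡ fromℕ (suc k)
    x-a = trans (cong (_- a) (fromℕ-+ (suc k) (suc m))) (solve 2 (λ k a → k :+ a :- a := k) refl (fromℕ (suc k)) a)
  zs = quotient-zero a cs (roots⇒zero n (quotient a cs) (trans (length-quotient a cs) (ℕ.suc-injective len)) (suc m) quotient-roots)

difference : List ℚ → List ℚ → List ℚ
difference cs [] = cs
difference [] (d ∷ ds) = - d ∷ difference [] ds
difference (c ∷ cs) (d ∷ ds) = c - d ∷ difference cs ds

horner-difference : ∀ cs ds x → horner (difference cs ds) x ≡ horner cs x - horner ds x
horner-difference cs [] x = sym (ℚ.+-identityʳ (horner cs x))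
horner-difference [] (d ∷ ds) x = trans (cong (λ u → x * u + - d) (horner-difference [] ds x))
  (solve 3 (λ x d h → x :* (con 0ℚ :- h) :- d := con 0ℚ :- (x :* h :+ d)) refl x d (horner ds x))
horner-difference (c ∷ cs) (d ∷ ds) x = trans (cong (λ u → x * u + (c - d)) (horner-difference cs ds x))
  (solve 5 (λ x c d g h → x :* (g :- h) :+ (c :- d) := x :* g :+ c :- (x :* h :+ d)) refl x c d (horner cs x) (horner ds x))

difference-zero : ∀ cs ds → ListAll (_≡ 0ℚ) (difference cs ds) → ∀ k → coefficient cs k ≡ coefficient ds k
difference-zero [] [] zs k = refl
difference-zero (c ∷ cs) [] (z ∷ zs) zero = z
difference-zero (c ∷ cs) [] (z ∷ zs) (suc k) = difference-zero cs [] zs k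
difference-zero [] (d ∷ ds) (z ∷ zs) zero = sym (ℚ.neg-injective z)
difference-zero [] (d ∷ ds) (z ∷ zs) (suc k) = difference-zero [] ds zs k
difference-zero (c ∷ cs) (d ∷ ds) (z ∷ zs) zero = x∙y⁻¹≈ε⇒x≈y c d z
difference-zero (c ∷ cs) (d ∷ ds) (z ∷ zs) (suc k) = difference-zero cs ds zs k

-- Coefficients are compared instead of lists because the lists may differ by trailing zeros.
horner-injective : ∀ cs ds → (∀ x → x ≢ 0ℚ → horner cs x ≡ horner ds x) → ∀ k → coefficient cs k ≡ coefficient ds k
horner-injective cs ds eq = difference-zero cs ds (roots⇒zero _ (difference cs ds) refl 0 λ k →
  trans (horner-difference cs ds _) (trans (cong (_- horner ds _) (eq _ (fromℕ-suc≢0 (k ℕ.+ 0)))) (ℚ.+-inverseʳ (horner ds _))))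

-- Canonicity of Horner normal forms

entry : ∀ {n} → List (Poly n) → ℕ → Poly n
entry [] k = κ 0ℚ
entry (p ∷ ps) zero = p
entry (p ∷ ps) (suc k) = entry ps k

-- The gap `Δ i` of a sparse Horner form stands for a factor x^i, that is, for `i` zero
-- coefficients.
pad : ∀ {n} → ℕ → List (Poly n) → List (Poly n)
pad zero ps = ps
pad (suc i) ps = κ 0ℚ ∷ pad i ps

dense : ∀ {n} → Coeff n ⋆ → List (Poly n)
dense [] = []
dense (∹ (p ≠0 Δ i & ps)) = pad i (p ∷ dense ps)

-- Coefficients with respect to the outermost variable. `≤′-step` records that this variable does
-- not occur, so the polynomial is its own constant term.
coefficients : ∀ {n} → Poly (suc n) → List (Poly n)
coefficients (f ⊐ ≤′-step i≤n) = (f ⊐ i≤n) ∷ []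
coefficients (⅀ ps ⊐ ≤′-refl) = dense (∹ ps)

-- Normal forms store nonzeroness as an irrelevant field, so it can only be used through
-- `⊥-elim-irr`.
κ0-zero : ∀ {n} {p : Poly n} → p ≡ κ 0ℚ → .(¬ Zero p) → ⊥
κ0-zero refl p≢0 = ⊥-elim-irr (p≢0 _)

pad-nonzero : ∀ {n} i {p : Poly n} {ps} → .(¬ Zero p) → ¬ (∀ k → entry (pad i (p ∷ ps)) k ≡ κ 0ℚ)
pad-nonzero zero p≢0 zs = κ0-zero (zs 0) p≢0
pad-nonzero (suc i) p≢0 zs = pad-nonzero i p≢0 (λ k → zs (suc k))

-- The coefficient after a gap is nonzero, so the length of the gap can be read off as the number of
-- leading zeros.
pad-injective : ∀ {n} i j {p q : Poly n} {ps qs} → .(¬ Zero p) → .(¬ Zero q) →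
  (∀ k → entry (pad i (p ∷ ps)) k ≡ entry (pad j (q ∷ qs)) k) →
  i ≡ j × p ≡ q × (∀ k → entry ps k ≡ entry qs k)
pad-injective zero zero _ _ eq = refl , eq 0 , λ k → eq (suc k)
pad-injective zero (suc j) p≢0 _ eq = ⊥-elim (κ0-zero (eq 0) p≢0)
pad-injective (suc i) zero _ q≢0 eq = ⊥-elim (κ0-zero (sym (eq 0)) q≢0)
pad-injective (suc i) (suc j) p≢0 q≢0 eq with pad-injective i j p≢0 q≢0 (λ k → eq (suc k))
... | refl , p≡q , ps≗qs = refl , p≡q , ps≗qs

dense-injective : ∀ {n} (ps qs : Coeff n ⋆) → (∀ k → entry (dense ps) k ≡ entry (dense qs) k) → ps ≡ qs
dense-injective [] [] eq = refl
dense-injective [] (∹ (_≠0 q {q≢0} Δ j & qs)) eq = contradiction (λ k → sym (eq k)) (pad-nonzero j q≢0)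
dense-injective (∹ (_≠0 p {p≢0} Δ i & ps)) [] eq = contradiction eq (pad-nonzero i p≢0)
dense-injective (∹ (_≠0 p {p≢0} Δ i & ps)) (∹ (_≠0 q {q≢0} Δ j & qs)) eq
  with pad-injective i j p≢0 q≢0 eq
... | refl , refl , ps≗qs with dense-injective ps qs ps≗qs
... | refl = refl

normalised-irrelevant : ∀ {n} (ps : Coeff n ⁺) (u v : Normalised ps) → u ≡ v
normalised-irrelevant (p Δ zero & ∹ ps) u v = refl
normalised-irrelevant (p Δ suc i & ps) u v = refl

-- Normalisation excludes a lone constant term, so a sum really involves its variable. This keeps
-- the two shapes of `Poly (suc n)` apart.
normalised-nonconstant : ∀ {n} (ps : Coeff n ⁺) → Normalised ps → ¬ (∀ k → entry (dense (∹ ps)) (suc k) ≡ κ 0ℚ)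
normalised-nonconstant (p Δ zero & ∹ (_≠0 q {q≢0} Δ j & qs)) _ = pad-nonzero j q≢0
normalised-nonconstant (_≠0 p {p≢0} Δ suc i & ps) _ = pad-nonzero i p≢0

coefficients-injective : ∀ {n} (p q : Poly (suc n)) → (∀ k → entry (coefficients p) k ≡ entry (coefficients q) k) → p ≡ q
coefficients-injective (f ⊐ ≤′-step i≤n) (g ⊐ ≤′-step j≤n) eq with eq 0
... | refl = refl
coefficients-injective (f ⊐ ≤′-step i≤n) (⅀ qs {qn} ⊐ ≤′-refl) eq =
  contradiction (λ k → sym (eq (suc k))) (normalised-nonconstant qs qn)
coefficients-injective (⅀ ps {pn} ⊐ ≤′-refl) (g ⊐ ≤′-step j≤n) eq =
  contradiction (λ k → eq (suc k)) (normalised-nonconstant ps pn)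
coefficients-injective (⅀ ps {pn} ⊐ ≤′-refl) (⅀ qs {qn} ⊐ ≤′-refl) eq with dense-injective (∹ ps) (∹ qs) eq
... | refl = cong (λ n → ⅀ ps {n} ⊐ ≤′-refl) (normalised-irrelevant ps pn qn)

module _ {n} (ρ : Vec ℚ n) where

  values : List (Poly n) → List ℚ
  values = map (λ p → ⟦ p ⟧ ρ)

  coefficient-values : ∀ ps k → coefficient (values ps) k ≡ ⟦ entry ps k ⟧ ρ
  coefficient-values [] k = refl
  coefficient-values (p ∷ ps) zero = refl
  coefficient-values (p ∷ ps) (suc k) = coefficient-values ps k

  horner-pad : ∀ i ps x → horner (values (pad i ps)) x ≡ horner (values ps) x *⟨ x ⟩^ i
  horner-pad zero ps x = refl
  horner-pad (suc i) ps x = begin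
    x * horner (values (pad i ps)) x + 0ℚ  ≡⟨ ℚ.+-identityʳ _ ⟩
    x * horner (values (pad i ps)) x
      ≡⟨ cong (x *_) (trans (horner-pad i ps x) (pow-opt (horner (values ps) x) x i)) ⟩
    x * (x ^ i * horner (values ps) x)       ≡⟨ ℚ.*-assoc x (x ^ i) _ ⟨
    x * x ^ i * horner (values ps) x        ≡⟨ cong (_* horner (values ps) x) (pow-suc x i) ⟨
    horner (values ps) x *⟨ x ⟩^ suc i      ∎
    where open ≡-Reasoning

  horner-dense : ∀ (ps : Coeff n ⁺) x → horner (values (dense (∹ ps))) x ≡ ⅀⟦ ps ⟧ (x , ρ)
  horner-dense (p ≠0 Δ i & []) x = trans (horner-pad i (p ∷ []) x)
    (cong (_*⟨ x ⟩^ i) (trans (cong (_+ ⟦ p ⟧ ρ) (ℚ.*-zeroʳ x)) (ℚ.+-identityˡ (⟦ p ⟧ ρ))))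
  horner-dense (p ≠0 Δ i & ∹ ps) x = trans (horner-pad i (p ∷ dense (∹ ps)) x)
    (cong (λ h → (x * h + ⟦ p ⟧ ρ) *⟨ x ⟩^ i) (horner-dense ps x))

  horner-coefficients : ∀ p x → horner (values (coefficients p)) x ≡ ⟦ p ⟧ (x ∷ ρ)
  horner-coefficients (Κ c ⊐ ≤′-step i≤n) x = trans (cong (_+ c) (ℚ.*-zeroʳ x)) (ℚ.+-identityˡ c)
  horner-coefficients (⅀ ps {pn} ⊐ ≤′-step i≤n) x =
    trans (cong (_+ ⟦ ⅀ ps {pn} ⊐ i≤n ⟧ ρ) (ℚ.*-zeroʳ x)) (ℚ.+-identityˡ (⟦ ⅀ ps {pn} ⊐ i≤n ⟧ ρ))
  horner-coefficients (⅀ ps ⊐ ≤′-refl) x = horner-dense ps x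

-- Induction on the number of variables. With `ρ` fixed, both sides are univariate in the outermost
-- variable and agree at every nonzero `x`, so their coefficients agree; these are the values at `ρ`
-- of polynomials in one variable fewer.
⟦⟧-injective : ∀ {n} (p q : Poly n) → (∀ ρ → All (_≢ 0ℚ) ρ → ⟦ p ⟧ ρ ≡ ⟦ q ⟧ ρ) → p ≡ q
⟦⟧-injective {zero} (Κ x ⊐ ≤′-refl) (Κ y ⊐ ≤′-refl) eq with eq [] []
... | refl = refl
⟦⟧-injective {suc n} p q eq = coefficients-injective p q λ k →
  ⟦⟧-injective (entry (coefficients p) k) (entry (coefficients q) k) λ ρ ρ≢0 →
    trans (sym (coefficient-values ρ (coefficients p) k)) (trans
      (horner-injective (values ρ (coefficients p)) (values ρ (coefficients q)) (λ x x≢0 →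
        trans (horner-coefficients ρ p x) (trans (eq (x ∷ ρ) (x≢0 ∷ ρ≢0)) (sym (horner-coefficients ρ q x)))) k)
      (coefficient-values ρ (coefficients q) k))

-- Parity and signs

isOdd-suc : ∀ n → isOdd (suc n) ≡ not (isOdd n)
isOdd-suc n with isOdd n
... | true = refl
... | false = refl

isOdd-suc⁻¹ : ∀ n {b} → isOdd (suc n) ≡ b → isOdd n ≡ not b
isOdd-suc⁻¹ n {b} eq = not-injective (trans (trans (sym (isOdd-suc n)) eq) (sym (not-involutive b)))

isOdd-2+⁻¹ : ∀ n {b} → isOdd (2 ℕ.+ n) ≡ b → isOdd n ≡ b
isOdd-2+⁻¹ n {b} eq = trans (isOdd-suc⁻¹ n (isOdd-suc⁻¹ (suc n) eq)) (not-involutive b)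

isOdd-+2* : ∀ n t → isOdd (n ℕ.+ t ℕ.+ t) ≡ isOdd n
isOdd-+2* n zero = cong isOdd (trans (ℕ.+-identityʳ (n ℕ.+ 0)) (ℕ.+-identityʳ n))
isOdd-+2* n (suc t) rewrite ℕ.+-suc n t | ℕ.+-suc (n ℕ.+ t) t =
  trans (isOdd-suc (suc (n ℕ.+ t ℕ.+ t))) (trans (cong not (isOdd-suc (n ℕ.+ t ℕ.+ t)))
    (trans (not-involutive _) (isOdd-+2* n t)))

even-or-odd : ∀ n → isOdd n ≡ false ⊎ isOdd n ≡ true
even-or-odd n with isOdd n
... | false = inj₁ refl
... | true = inj₂ refl

sgn : ℕ → ℚ
sgn zero = 1ℚ
sgn (suc t) = - sgn t

sgn² : ∀ t → sgn t * sgn t ≡ 1ℚ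
sgn² zero = refl
sgn² (suc t) = trans (solve 1 (λ s → :- s :* :- s := s :* s) refl (sgn t)) (sgn² t)

sgn≢0 : ∀ t → sgn t ≢ 0ℚ
sgn≢0 t s≡0 with trans (sym (sgn² t)) (trans (cong (_* sgn t) s≡0) (ℚ.*-zeroˡ (sgn t)))
... | ()

sgn-even : ∀ n → isOdd n ≡ false → sgn n ≡ 1ℚ
sgn-odd : ∀ n → isOdd n ≡ true → sgn n ≡ - 1ℚ
sgn-even zero _ = refl
sgn-even (suc n) even = cong -_ (sgn-odd n (isOdd-suc⁻¹ n even))
sgn-odd (suc n) odd = cong -_ (sgn-even n (isOdd-suc⁻¹ n odd))

sgn-+ : ∀ m n → sgn (m ℕ.+ n) ≡ sgn m * sgn n
sgn-+ zero n = sym (ℚ.*-identityˡ (sgn n))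
sgn-+ (suc m) n = trans (cong -_ (sgn-+ m n)) (ℚ.neg-distribˡ-* (sgn m) (sgn n))

-- The array B p t = a_{p,-t}

module Array (r : ℕ) (B : ℕ → ℕ → ℚ)
  (B-top : ∀ p → B p 0 ≡ 1ℚ)
  (B-left : ∀ t → B 0 t ≡ 1ℚ)
  (B-right : ∀ t → B (suc r) t ≡ 1ℚ)
  (B≢0 : ∀ p t → B p t ≢ 0ℚ)
  (B-step : ∀ p t → p < r →
    B (suc p) (2 ℕ.+ t) * B (suc p) t ≡ - (B p (suc t) * B (2 ℕ.+ p) (suc t)))
  where

  a : ℕ → ℚ
  a p = B p 1

  ≡-*1 : ∀ {x y z} → z ≡ 1ℚ → x ≡ y → x ≡ y * z
  ≡-*1 {y = y} refl x≡y = trans x≡y (sym (ℚ.*-identityʳ y))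

  -- `B-step` says that the ratio belonging to (p, t + 1) is minus the one belonging to (p + 1, t).
  -- It can thus be pushed to level 0, where it is an indeterminate or the edge value 1.
  B-diagonal : ∀ t p → p ℕ.+ t ≤ r → B (suc p) (suc t) ≡ sgn t * a (suc (p ℕ.+ t)) * B p t
  B-diagonal zero p _ rewrite ℕ.+-identityʳ p = ≡-*1 (B-top p) (sym (ℚ.*-identityˡ (a (suc p))))
  B-diagonal (suc t) p p+t≤r rewrite ℕ.+-suc p t = *-cancelʳ-≢0 (B≢0 (suc p) t) (begin
    B (suc p) (2 ℕ.+ t) * z                  ≡⟨ B-step p t (ℕ.≤-trans (s≤s (ℕ.m≤m+n p t)) p+t≤r) ⟩
    - (B p (suc t) * B (2 ℕ.+ p) (suc t))    ≡⟨ cong (λ u → - (B p (suc t) * u)) (B-diagonal t (suc p) p+t≤r) ⟩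
    - (B p (suc t) * (sgn t * α * z))
      ≡⟨ solve 4 (λ b s α z → :- (b :* (s :* α :* z)) := :- s :* α :* b :* z) refl (B p (suc t)) (sgn t) α z ⟩
    - sgn t * α * B p (suc t) * z            ∎)
    where
    open ≡-Reasoning
    α = a (2 ℕ.+ (p ℕ.+ t))
    z = B (suc p) t

  -- Mirror image of `B-diagonal` under p ↦ r + 1 - p. Writing the position as `u + t` exhibits the
  -- invariant `u` of the ratio.
  B-antidiagonal : ∀ t u → u ℕ.+ t ≤ r → B (u ℕ.+ t) (suc t) ≡ sgn t * a u * B (suc (u ℕ.+ t)) t
  B-antidiagonal zero u _ rewrite ℕ.+-identityʳ u = ≡-*1 (B-top (suc u)) (sym (ℚ.*-identityˡ (a u)))
  B-antidiagonal (suc t) u u+t≤r rewrite ℕ.+-suc u t = *-cancelʳ-≢0 (B≢0 (suc (u ℕ.+ t)) t) (begin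
    B (suc (u ℕ.+ t)) (2 ℕ.+ t) * z      ≡⟨ B-step (u ℕ.+ t) t u+t≤r ⟩
    - (B (u ℕ.+ t) (suc t) * b)          ≡⟨ cong (λ v → - (v * b)) (B-antidiagonal t u (ℕ.<⇒≤ u+t≤r)) ⟩
    - (sgn t * a u * z * b)
      ≡⟨ solve 4 (λ b s α z → :- (s :* α :* z :* b) := :- s :* α :* b :* z) refl b (sgn t) (a u) z ⟩
    - sgn t * a u * b * z                ∎)
    where
    open ≡-Reasoning
    z = B (suc (u ℕ.+ t)) t
    b = B (2 ℕ.+ (u ℕ.+ t)) (suc t)

  -- The inverse ratio, anchored at the edge r + 1, where the array is 1, instead of at level 0. Its
  -- value `B r w` involves no division; `v` is the distance to that anchor.
  B-diagonal-right : ∀ v p w → p ℕ.+ v ≡ r → B p (v ℕ.+ w) ≡ sgn v * B r w * B (suc p) (suc (v ℕ.+ w))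
  B-diagonal-right zero p w eq rewrite trans (sym (ℕ.+-identityʳ p)) eq =
    ≡-*1 (B-right (suc w)) (sym (ℚ.*-identityˡ (B r w)))
  B-diagonal-right (suc v) p w eq = *-cancelʳ-≢0 (B≢0 (2 ℕ.+ p) (suc (v ℕ.+ w))) (begin
    b * z                                    ≡⟨ solve 1 (λ x → x := :- (:- x)) refl (b * z) ⟩
    - - (b * z)                              ≡⟨ cong -_ (B-step p (v ℕ.+ w) p<r) ⟨
    - (b′ * B (suc p) (v ℕ.+ w))
      ≡⟨ cong (λ u → - (b′ * u)) (B-diagonal-right v (suc p) w (trans (sym (ℕ.+-suc p v)) eq)) ⟩
    - (b′ * (sgn v * B r w * z))
      ≡⟨ solve 4 (λ b s β z → :- (b :* (s :* β :* z)) := :- s :* β :* b :* z) refl b′ (sgn v) (B r w) z ⟩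
    - sgn v * B r w * b′ * z                 ∎)
    where
    open ≡-Reasoning
    p<r : p < r
    p<r = subst (p <_) eq (ℕ.m<m+n p (s≤s z≤n))
    z = B (2 ℕ.+ p) (suc (v ℕ.+ w))
    b = B p (suc (v ℕ.+ w))
    b′ = B (suc p) (2 ℕ.+ (v ℕ.+ w))

  -- Mirror image of `B-diagonal-right`, anchored at the edge 0.
  B-antidiagonal-left : ∀ p w → p ≤ r → B (suc p) (p ℕ.+ w) ≡ sgn p * B 1 w * B p (suc (p ℕ.+ w))
  B-antidiagonal-left zero w _ = ≡-*1 (B-left (suc w)) (sym (ℚ.*-identityˡ (B 1 w)))
  B-antidiagonal-left (suc p) w p<r = *-cancelʳ-≢0 (B≢0 p (suc (p ℕ.+ w))) (begin
    b * z                                    ≡⟨ solve 2 (λ x y → x :* y := :- (:- (y :* x))) refl b z ⟩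
    - - (z * b)                              ≡⟨ cong -_ (B-step p (p ℕ.+ w) p<r) ⟨
    - (b′ * B (suc p) (p ℕ.+ w))             ≡⟨ cong (λ u → - (b′ * u)) (B-antidiagonal-left p w (ℕ.<⇒≤ p<r)) ⟩
    - (b′ * (sgn p * B 1 w * z))
      ≡⟨ solve 4 (λ b s β z → :- (b :* (s :* β :* z)) := :- s :* β :* b :* z) refl b′ (sgn p) (B 1 w) z ⟩
    - sgn p * B 1 w * b′ * z                 ∎)
    where
    open ≡-Reasoning
    z = B p (suc (p ℕ.+ w))
    b = B (2 ℕ.+ p) (suc (p ℕ.+ w))
    b′ = B (suc p) (2 ℕ.+ (p ℕ.+ w))

  B-first : ∀ t → t ≤ r → B 1 (suc t) ≡ sgn t * a (suc t)
  B-first t t≤r = trans (B-diagonal t 0 t≤r) (trans (cong (sgn t * a (suc t) *_) (B-left t)) (ℚ.*-identityʳ _))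

  B-last : ∀ t u → u ℕ.+ t ≡ r → B r (suc t) ≡ sgn t * a u
  B-last t u refl = trans (B-antidiagonal t u ℕ.≤-refl) (trans (cong (sgn t * a u *_) (B-right t)) (ℚ.*-identityʳ _))

  -- `B (suc p) r` is computed from the left edge and from the right edge. Both coefficients are
  -- `a (suc w)` up to sign, with equal total signs, so it cancels and level r + 1 has period 2.
  B-bottom-2+ : ∀ p w → p ℕ.+ suc w ≡ r → B p (suc r) ≡ B (2 ℕ.+ p) (suc r)
  B-bottom-2+ p w refl = *-cancelʳ-≢0 (*-≢0 (*-≢0 (sgn≢0 p) (sgn≢0 w)) (B≢0 (suc w) 1)) (begin
    B p (suc r) * (sgn p * sgn w * α)
      ≡⟨ solve 4 (λ b s t α → b :* (s :* t :* α) := s :* (t :* α) :* b) refl (B p (suc r)) (sgn p) (sgn w) α ⟩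
    sgn p * (sgn w * α) * B p (suc r)
      ≡⟨ cong (λ u → sgn p * u * B p (suc r)) (B-first w (ℕ.≤-trans (ℕ.n≤1+n w) (ℕ.m≤n+m (suc w) p))) ⟨
    sgn p * B 1 (suc w) * B p (suc r)   ≡⟨ B-antidiagonal-left p (suc w) (ℕ.m≤m+n p (suc w)) ⟨
    B (suc p) r                         ≡⟨ cong (B (suc p)) r≡ ⟩
    B (suc p) (w ℕ.+ suc p)             ≡⟨ B-diagonal-right w (suc p) (suc p) (sym (ℕ.+-suc p w)) ⟩
    sgn w * B r (suc p) * B (2 ℕ.+ p) (suc (w ℕ.+ suc p))
      ≡⟨ cong (λ n → sgn w * B r (suc p) * B (2 ℕ.+ p) (suc n)) r≡ ⟨
    sgn w * B r (suc p) * b             ≡⟨ cong (λ u → sgn w * u * b) (B-last p (suc w) (ℕ.+-comm (suc w) p)) ⟩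
    sgn w * (sgn p * α) * b
      ≡⟨ solve 4 (λ b s t α → t :* (s :* α) :* b := b :* (s :* t :* α)) refl b (sgn p) (sgn w) α ⟩
    b * (sgn p * sgn w * α)             ∎)
    where
    open ≡-Reasoning
    α = a (suc w)
    b = B (2 ℕ.+ p) (suc r)
    r≡ : r ≡ w ℕ.+ suc p
    r≡ = trans (ℕ.+-comm p (suc w)) (sym (ℕ.+-suc w p))

  B-bottom-even : ∀ p w → p ℕ.+ w ≡ suc r → isOdd w ≡ false → B p (suc r) ≡ 1ℚ
  B-bottom-even p zero eq _ rewrite trans (sym (ℕ.+-identityʳ p)) eq = B-right (suc r)
  B-bottom-even p (suc (suc w)) eq even =
    trans (B-bottom-2+ p w (ℕ.suc-injective (trans (sym (ℕ.+-suc p (suc w))) eq)))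
      (B-bottom-even (2 ℕ.+ p) w (trans (sym (trans (ℕ.+-suc p (suc w)) (cong suc (ℕ.+-suc p w)))) eq) (isOdd-2+⁻¹ w even))

  B-bottom-odd : ∀ p w → p ℕ.+ w ≡ suc r → isOdd w ≡ true → B p (suc r) ≡ sgn r
  -- The antidiagonal into the corner starts at `B 0 1`, which is 1, so only the sign is left.
  B-bottom-odd p (suc zero) eq _ rewrite ℕ.suc-injective (trans (ℕ.+-comm 1 p) eq) =
    trans (B-last r 0 refl) (trans (cong (sgn r *_) (B-left 1)) (ℚ.*-identityʳ (sgn r)))
  B-bottom-odd p (suc (suc w)) eq odd =
    trans (B-bottom-2+ p w (ℕ.suc-injective (trans (sym (ℕ.+-suc p (suc w))) eq)))
      (B-bottom-odd (2 ℕ.+ p) w (trans (sym (trans (ℕ.+-suc p (suc w)) (cong suc (ℕ.+-suc p w)))) eq) (isOdd-2+⁻¹ w odd))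

  -- x t p is the entry in row p of a fixed column of P_t, with zero rows 0 and r + 2 added.
  module Rows (x : ℕ → ℕ → ℚ)
    (x-left : ∀ t → x t 0 ≡ 0ℚ)
    (x-right : ∀ t → x t (2 ℕ.+ r) ≡ 0ℚ)
    (x-same : ∀ m p → p ≤ r → isOdd (p ℕ.+ m) ≡ false → x (suc m) (suc p) ≡ x m (suc p))
    (x-step : ∀ m p → p ≤ r → isOdd (p ℕ.+ m) ≡ true →
      B p m * B (suc p) m * x (suc m) (suc p) ≡
        B (suc p) (suc m) * B (suc p) m * x m p
        + B p (suc m) * B (suc p) (suc m) * x m (suc p)
        + B p (suc m) * B p m * x m (2 ℕ.+ p))
    where

    -- `e` is the initial column; `c` and `d` are the inhomogeneous terms of the diagonal and the
    -- antidiagonal law. The reflection of rows k ↦ r + 2 - k, with a_k ↦ a_{r+1-k}, exchanges them.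
    -- They reappear as entries of the first and the last row (`x-first`, `x-last`).
    e c d : ℕ → ℚ
    e = x 0
    c k = a k * e k + e (suc k)
    d k = e k + a k * e (suc k)

    x-step-0 : ∀ p → p ≤ r → isOdd p ≡ true →
      x 1 (suc p) ≡ a (suc p) * e p + a p * a (suc p) * e (suc p) + a p * e (2 ℕ.+ p)
    x-step-0 p p≤r odd with x-step 0 p p≤r (trans (cong isOdd (ℕ.+-identityʳ p)) odd)
    ... | eq rewrite B-top p | B-top (suc p) =
      trans (solve 1 (λ y → y := con 1ℚ :* con 1ℚ :* y) refl (x 1 (suc p))) (trans eq
        (solve 5 (λ α β e₀ e₁ e₂ → β :* con 1ℚ :* e₀ :+ α :* β :* e₁ :+ α :* con 1ℚ :* e₂ :=
          β :* e₀ :+ α :* β :* e₁ :+ α :* e₂) refl (a p) (a (suc p)) (e p) (e (suc p)) (e (2 ℕ.+ p))))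

    -- The induction hypothesis, one position to the right, expresses `x (suc t) (2 + p)` through
    -- `x t (suc p)`, which by parity equals `x (suc t) (suc p)`. In the three-term recursion the
    -- two contributions of this middle entry then cancel, which leaves a first-order law.
    x-diagonal : ∀ t p → p ℕ.+ t ≤ r → isOdd (p ℕ.+ t) ≡ true →
      x (suc t) (suc p) ≡ sgn t * a (suc (p ℕ.+ t)) * x t p + B p (suc t) * c (suc (p ℕ.+ t))
    x-diagonal zero p p≤r odd rewrite ℕ.+-identityʳ p = trans (x-step-0 p p≤r odd)
      (solve 5 (λ α β e₀ e₁ e₂ → β :* e₀ :+ α :* β :* e₁ :+ α :* e₂ :=
        con 1ℚ :* β :* e₀ :+ α :* (β :* e₁ :+ e₂)) refl (a p) (a (suc p)) (e p) (e (suc p)) (e (2 ℕ.+ p)))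
    x-diagonal (suc t) p p+t≤r odd = lemma
      {B p (suc t)} {B (suc p) (suc t)} {B p (suc (suc t))} {B (suc p) (suc (suc t))}
      {x (suc (suc t)) (suc p)} {x (suc t) p} {x (suc t) (suc p)} {x (suc t) (2 ℕ.+ p)}
      {sgn t} {a (suc (p ℕ.+ suc t))} {c (suc (p ℕ.+ suc t))}
      (B≢0 p (suc t)) (B≢0 (suc p) (suc t))
      (x-step (suc t) p p≤r odd)
      (B-diagonal (suc t) p p+t≤r)
      (trans (x-diagonal t (suc p) (subst (_≤ r) (ℕ.+-suc p t) p+t≤r) (trans (cong isOdd (sym (ℕ.+-suc p t))) odd))
        (cong₂ _+_
          (cong₂ (λ n y → sgn t * a n * y) (cong suc (sym (ℕ.+-suc p t)))
            (sym (x-same t p p≤r (isOdd-suc⁻¹ (p ℕ.+ t) (trans (cong isOdd (sym (ℕ.+-suc p t))) odd)))))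
          (cong (λ n → B (suc p) (suc t) * c (suc n)) (sym (ℕ.+-suc p t)))))
      where
      p≤r : p ≤ r
      p≤r = ℕ.≤-trans (ℕ.m≤m+n p (suc t)) p+t≤r
      -- `P`, `Q` are the array values at `p`, `p + 1` on the current level and `P′`, `Q′` those on
      -- the next. After substitution for `Q′` and `x₂` the terms in `x₁` are opposite.
      lemma : ∀ {P Q P′ Q′ y x₀ x₁ x₂ s α c} → P ≢ 0ℚ → Q ≢ 0ℚ →
        P * Q * y ≡ Q′ * Q * x₀ + P′ * Q′ * x₁ + P′ * P * x₂ →
        Q′ ≡ - s * α * P → x₂ ≡ s * α * x₁ + Q * c →
        y ≡ - s * α * x₀ + P′ * c
      lemma {P} {Q} {P′} {_} {y} {x₀} {x₁} {_} {s} {α} {c} P≢0 Q≢0 eq refl refl = *-cancelʳ-≢0 (*-≢0 P≢0 Q≢0)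
        (trans (ℚ.*-comm y (P * Q)) (trans eq (solve 8 (λ P Q P′ x₀ x₁ s α c →
          :- s :* α :* P :* Q :* x₀ :+ P′ :* (:- s :* α :* P) :* x₁ :+ P′ :* P :* (s :* α :* x₁ :+ Q :* c) :=
          (:- s :* α :* x₀ :+ P′ :* c) :* (P :* Q)) refl P Q P′ x₀ x₁ s α c)))

    -- Mirror image of `x-diagonal`: now it is the left neighbour `x₀` that the induction hypothesis
    -- eliminates. The parity condition reduces to `u` alone because `t` enters twice.
    x-antidiagonal : ∀ t u → u ℕ.+ t ≤ r → isOdd u ≡ true →
      x (suc t) (suc (u ℕ.+ t)) ≡ sgn t * a u * x t (2 ℕ.+ (u ℕ.+ t)) + B (suc (u ℕ.+ t)) (suc t) * d u
    x-antidiagonal zero u u≤r odd rewrite ℕ.+-identityʳ u = trans (x-step-0 u u≤r odd)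
      (solve 5 (λ α β e₀ e₁ e₂ → β :* e₀ :+ α :* β :* e₁ :+ α :* e₂ :=
        con 1ℚ :* α :* e₂ :+ β :* (e₀ :+ α :* e₁)) refl (a u) (a (suc u)) (e u) (e (suc u)) (e (2 ℕ.+ u)))
    x-antidiagonal (suc t) u u+t≤r odd = lemma
      {B (u ℕ.+ suc t) (suc t)} {B (suc (u ℕ.+ suc t)) (suc t)}
      {B (u ℕ.+ suc t) (suc (suc t))} {B (suc (u ℕ.+ suc t)) (suc (suc t))}
      {x (suc (suc t)) (suc (u ℕ.+ suc t))} {x (suc t) (u ℕ.+ suc t)}
      {x (suc t) (suc (u ℕ.+ suc t))} {x (suc t) (2 ℕ.+ (u ℕ.+ suc t))}
      {sgn t} {a u} {d u}
      (B≢0 (u ℕ.+ suc t) (suc t)) (B≢0 (suc (u ℕ.+ suc t)) (suc t))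
      (x-step (suc t) (u ℕ.+ suc t) u+t≤r (trans (isOdd-+2* u (suc t)) odd))
      (B-antidiagonal (suc t) u u+t≤r)
      (trans (cong (x (suc t)) (ℕ.+-suc u t)) (trans (x-antidiagonal t u (ℕ.<⇒≤ u+t<r) odd)
        (cong₂ _+_
          (cong (sgn t * a u *_) (trans (sym (x-same t (suc (u ℕ.+ t)) u+t<r parity)) (cong (λ n → x (suc t) (suc n)) (sym (ℕ.+-suc u t)))))
          (cong (λ n → B n (suc t) * d u) (sym (ℕ.+-suc u t))))))
      where
      u+t<r : suc (u ℕ.+ t) ≤ r
      u+t<r = subst (_≤ r) (ℕ.+-suc u t) u+t≤r
      parity : isOdd (suc (u ℕ.+ t) ℕ.+ t) ≡ false
      parity = trans (isOdd-suc (u ℕ.+ t ℕ.+ t)) (cong not (trans (isOdd-+2* u t) odd))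
      lemma : ∀ {P Q P′ Q′ y x₀ x₁ x₂ s α d} → P ≢ 0ℚ → Q ≢ 0ℚ →
        P * Q * y ≡ Q′ * Q * x₀ + P′ * Q′ * x₁ + P′ * P * x₂ →
        P′ ≡ - s * α * Q → x₀ ≡ s * α * x₁ + P * d →
        y ≡ - s * α * x₂ + Q′ * d
      lemma {P} {Q} {_} {Q′} {y} {_} {x₁} {x₂} {s} {α} {d} P≢0 Q≢0 eq refl refl = *-cancelʳ-≢0 (*-≢0 P≢0 Q≢0)
        (trans (ℚ.*-comm y (P * Q)) (trans eq (solve 8 (λ P Q Q′ x₁ x₂ s α d →
          Q′ :* Q :* (s :* α :* x₁ :+ P :* d) :+ (:- s :* α :* Q) :* Q′ :* x₁ :+ (:- s :* α :* Q) :* P :* x₂ :=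
          (:- s :* α :* x₂ :+ Q′ :* d) :* (P :* Q)) refl P Q Q′ x₁ x₂ s α d)))

    -- The recursion is solved for its left old entry instead of the new one, so that the
    -- coefficient is `B r w` and not its inverse. The induction starts at the zero row r + 2, and
    -- the last-row entry `x w (suc r)` takes over the part of `c`.
    x-diagonal-right : ∀ v p w → p ℕ.+ v ≡ r → isOdd (r ℕ.+ w) ≡ true →
      x (v ℕ.+ w) p ≡ sgn v * B r w * x (suc (v ℕ.+ w)) (suc p) - sgn v * B p (suc (v ℕ.+ w)) * x w (suc r)
    x-diagonal-right zero p w eq odd rewrite trans (sym (ℕ.+-identityʳ p)) eq =
      lemma {B r w} {B (suc r) w} {B r (suc w)} {B (suc r) (suc w)} {x (suc w) (suc r)} {x w r} {x w (suc r)}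
        (B-right w) (B-right (suc w)) (x-right w) (x-step w r ℕ.≤-refl odd)
      where
      lemma : ∀ {P Q P′ Q′ y x₀ x₁ x₂} → Q ≡ 1ℚ → Q′ ≡ 1ℚ → x₂ ≡ 0ℚ →
        P * Q * y ≡ Q′ * Q * x₀ + P′ * Q′ * x₁ + P′ * P * x₂ →
        x₀ ≡ 1ℚ * P * y - 1ℚ * P′ * x₁
      lemma {P} {_} {P′} {_} {y} {x₀} {x₁} refl refl refl eq = begin
        x₀
          ≡⟨ solve 4 (λ P P′ x₀ x₁ → x₀ := con 1ℚ :* con 1ℚ :* x₀ :+ P′ :* con 1ℚ :* x₁ :+ P′ :* P :* con 0ℚ :- con 1ℚ :* P′ :* x₁)
               refl P P′ x₀ x₁ ⟩
        1ℚ * 1ℚ * x₀ + P′ * 1ℚ * x₁ + P′ * P * 0ℚ - 1ℚ * P′ * x₁  ≡⟨ cong (_- 1ℚ * P′ * x₁) eq ⟨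
        P * 1ℚ * y - 1ℚ * P′ * x₁  ≡⟨ cong (λ u → u * y - 1ℚ * P′ * x₁) (ℚ.*-comm P 1ℚ) ⟩
        1ℚ * P * y - 1ℚ * P′ * x₁  ∎
        where open ≡-Reasoning
    x-diagonal-right (suc v) p w eq odd = lemma
      {B p m} {B (suc p) m} {B p (suc m)} {B (suc p) (suc m)}
      {x (suc m) (suc p)} {x m p} {x m (suc p)} {x m (2 ℕ.+ p)}
      {sgn v} {B r w} {x w (suc r)}
      (B≢0 (suc p) m) (B≢0 (suc p) (suc m))
      (x-step m p p≤r (trans (cong isOdd p+m≡r+w) odd))
      (B-diagonal-right (suc v) p w eq)
      (trans (x-same (v ℕ.+ w) p p≤r (isOdd-suc⁻¹ (p ℕ.+ (v ℕ.+ w)) (trans (cong isOdd (trans (sym (ℕ.+-suc p (v ℕ.+ w))) p+m≡r+w)) odd)))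
        (x-diagonal-right v (suc p) w (trans (sym (ℕ.+-suc p v)) eq) odd))
      where
      m = suc (v ℕ.+ w)
      p≤r : p ≤ r
      p≤r = subst (p ≤_) eq (ℕ.m≤m+n p (suc v))
      p+m≡r+w : p ℕ.+ m ≡ r ℕ.+ w
      p+m≡r+w = trans (sym (ℕ.+-assoc p (suc v) w)) (cong (ℕ._+ w) eq)
      lemma : ∀ {P Q P′ Q′ y x₀ x₁ x₂ s β D} → Q ≢ 0ℚ → Q′ ≢ 0ℚ →
        P * Q * y ≡ Q′ * Q * x₀ + P′ * Q′ * x₁ + P′ * P * x₂ →
        P ≡ - s * β * Q′ → x₁ ≡ s * β * x₂ - s * Q * D →
        x₀ ≡ - s * β * y - - s * P′ * D
      lemma {_} {Q} {P′} {Q′} {y} {x₀} {_} {x₂} {s} {β} {D} Q≢0 Q′≢0 eq refl refl = *-cancelʳ-≢0 (*-≢0 Q′≢0 Q≢0) (begin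
        x₀ * (Q′ * Q) ≡⟨ solve 8 (λ Q P′ Q′ x₀ x₂ s β D → x₀ :* (Q′ :* Q) :=
            Q′ :* Q :* x₀ :+ P′ :* Q′ :* (s :* β :* x₂ :- s :* Q :* D) :+ P′ :* (:- s :* β :* Q′) :* x₂ :+ s :* P′ :* D :* (Q′ :* Q))
            refl Q P′ Q′ x₀ x₂ s β D ⟩
        Q′ * Q * x₀ + P′ * Q′ * (s * β * x₂ - s * Q * D) + P′ * (- s * β * Q′) * x₂ + s * P′ * D * (Q′ * Q)
          ≡⟨ cong (_+ s * P′ * D * (Q′ * Q)) eq ⟨
        - s * β * Q′ * Q * y + s * P′ * D * (Q′ * Q)  ≡⟨ solve 7 (λ Q P′ Q′ y s β D →
            :- s :* β :* Q′ :* Q :* y :+ s :* P′ :* D :* (Q′ :* Q) := (:- s :* β :* y :- (:- s :* P′ :* D)) :* (Q′ :* Q)) refl Q P′ Q′ y s β D ⟩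
        (- s * β * y - - s * P′ * D) * (Q′ * Q)  ∎)
        where open ≡-Reasoning

    -- Mirror image of `x-diagonal-right`, starting at the zero row 0. Together the two reversed
    -- laws meet on the bottom level.
    x-antidiagonal-left : ∀ p w → p ≤ r → isOdd w ≡ true →
      x (p ℕ.+ w) (2 ℕ.+ p) ≡ sgn p * B 1 w * x (suc (p ℕ.+ w)) (suc p) - sgn p * B (suc p) (suc (p ℕ.+ w)) * x w 1
    x-antidiagonal-left zero w p≤r odd =
      lemma {B 0 w} {B 1 w} {B 0 (suc w)} {B 1 (suc w)} {x (suc w) 1} {x w 0} {x w 1}
        (B-left w) (B-left (suc w)) (x-left w) (x-step w 0 p≤r odd)
      where
      lemma : ∀ {P Q P′ Q′ y x₀ x₁ x₂} → P ≡ 1ℚ → P′ ≡ 1ℚ → x₀ ≡ 0ℚ →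
        P * Q * y ≡ Q′ * Q * x₀ + P′ * Q′ * x₁ + P′ * P * x₂ →
        x₂ ≡ 1ℚ * Q * y - 1ℚ * Q′ * x₁
      lemma {_} {Q} {_} {Q′} {y} {_} {x₁} {x₂} refl refl refl eq = begin
        x₂
          ≡⟨ solve 4 (λ Q Q′ x₁ x₂ → x₂ := Q′ :* Q :* con 0ℚ :+ con 1ℚ :* Q′ :* x₁ :+ con 1ℚ :* con 1ℚ :* x₂ :- con 1ℚ :* Q′ :* x₁)
               refl Q Q′ x₁ x₂ ⟩
        Q′ * Q * 0ℚ + 1ℚ * Q′ * x₁ + 1ℚ * 1ℚ * x₂ - 1ℚ * Q′ * x₁  ≡⟨ cong (_- 1ℚ * Q′ * x₁) eq ⟨
        1ℚ * Q * y - 1ℚ * Q′ * x₁  ∎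
        where open ≡-Reasoning
    x-antidiagonal-left (suc p) w p<r odd = lemma
      {B (suc p) m} {B (suc (suc p)) m} {B (suc p) (suc m)} {B (suc (suc p)) (suc m)}
      {x (suc m) (suc (suc p))} {x m (suc p)} {x m (suc (suc p))} {x m (2 ℕ.+ (suc p))}
      {sgn p} {B 1 w} {x w 1}
      (B≢0 (suc p) m) (B≢0 (suc p) (suc m))
      (x-step m (suc p) p<r (trans (isOdd-suc (p ℕ.+ m)) (cong not (trans (cong isOdd (ℕ.+-suc p (p ℕ.+ w))) (trans (isOdd-suc (p ℕ.+ (p ℕ.+ w))) (cong not p+p+w-odd))))))
      (B-antidiagonal-left (suc p) w p<r)
      (trans (x-same (p ℕ.+ w) (suc p) p<r (trans (isOdd-suc (p ℕ.+ (p ℕ.+ w))) (cong not p+p+w-odd)))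
        (x-antidiagonal-left p w (ℕ.<⇒≤ p<r) odd))
      where
      m = suc (p ℕ.+ w)
      p+p+w-odd : isOdd (p ℕ.+ (p ℕ.+ w)) ≡ true
      p+p+w-odd = trans (cong isOdd (trans (ℕ.+-comm p (p ℕ.+ w)) (cong (ℕ._+ p) (ℕ.+-comm p w)))) (trans (isOdd-+2* w p) odd)
      lemma : ∀ {P Q P′ Q′ y x₀ x₁ x₂ s β D} → P ≢ 0ℚ → P′ ≢ 0ℚ →
        P * Q * y ≡ Q′ * Q * x₀ + P′ * Q′ * x₁ + P′ * P * x₂ →
        Q ≡ - s * β * P′ → x₁ ≡ s * β * x₀ - s * P * D →
        x₂ ≡ - s * β * y - - s * Q′ * D
      lemma {P} {_} {P′} {Q′} {y} {x₀} {_} {x₂} {s} {β} {D} P≢0 P′≢0 eq refl refl = *-cancelʳ-≢0 (*-≢0 P′≢0 P≢0) (begin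
        x₂ * (P′ * P) ≡⟨ solve 8 (λ P P′ Q′ x₀ x₂ s β D → x₂ :* (P′ :* P) :=
            Q′ :* (:- s :* β :* P′) :* x₀ :+ P′ :* Q′ :* (s :* β :* x₀ :- s :* P :* D) :+ P′ :* P :* x₂ :+ s :* Q′ :* D :* (P′ :* P))
            refl P P′ Q′ x₀ x₂ s β D ⟩
        Q′ * (- s * β * P′) * x₀ + P′ * Q′ * (s * β * x₀ - s * P * D) + P′ * P * x₂ + s * Q′ * D * (P′ * P)
          ≡⟨ cong (_+ s * Q′ * D * (P′ * P)) eq ⟨
        P * (- s * β * P′) * y + s * Q′ * D * (P′ * P)  ≡⟨ solve 7 (λ P P′ Q′ y s β D →
            P :* (:- s :* β :* P′) :* y :+ s :* Q′ :* D :* (P′ :* P) := (:- s :* β :* y :- (:- s :* Q′ :* D)) :* (P′ :* P)) refl P P′ Q′ y s β D ⟩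
        (- s * β * y - - s * Q′ * D) * (P′ * P)  ∎)
        where open ≡-Reasoning

    x-first : ∀ t → t ≤ r → isOdd t ≡ true → x (suc t) 1 ≡ c (suc t)
    x-first t t≤r odd = trans (x-diagonal t 0 t≤r odd) (lemma {sgn t * a (suc t)} (x-left t) (B-left (suc t)))
      where
      lemma : ∀ {s y b c} → y ≡ 0ℚ → b ≡ 1ℚ → s * y + b * c ≡ c
      lemma {s} {_} {_} {c} refl refl = solve 2 (λ s c → s :* con 0ℚ :+ con 1ℚ :* c := c) refl s c

    x-last : ∀ t u → u ℕ.+ t ≡ r → isOdd u ≡ true → x (suc t) (suc r) ≡ d u
    x-last t u refl odd = trans (x-antidiagonal t u ℕ.≤-refl odd) (lemma {sgn t * a u} (x-right t) (B-right (suc t)))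
      where
      lemma : ∀ {s y b d} → y ≡ 0ℚ → b ≡ 1ℚ → s * y + b * d ≡ d
      lemma {s} {_} {_} {d} refl refl = solve 2 (λ s c → s :* con 0ℚ :+ con 1ℚ :* c := c) refl s d

    x-first-even : ∀ t → t ≤ suc r → isOdd t ≡ false → x (suc t) 1 ≡ c t
    -- `c 0` is `e 1` because row 0 is zero.
    x-first-even zero _ _ = trans (x-same 0 0 z≤n refl) (sym (trans (cong (λ u → a 0 * u + e 1) (x-left 0))
      (trans (cong (_+ e 1) (ℚ.*-zeroʳ (a 0))) (ℚ.+-identityˡ (e 1)))))
    x-first-even (suc t) (s≤s t≤r) even = trans (x-same (suc t) 0 z≤n even) (x-first t t≤r (isOdd-suc⁻¹ t even))

    x-last-next : ∀ t u → u ℕ.+ t ≡ r → isOdd u ≡ true → x (2 ℕ.+ t) (suc r) ≡ d u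
    x-last-next t u u+t≡r odd = trans (x-same (suc t) r ℕ.≤-refl parity) (x-last t u u+t≡r odd)
      where
      parity : isOdd (r ℕ.+ suc t) ≡ false
      parity = trans (cong isOdd (ℕ.+-suc r t)) (trans (isOdd-suc (r ℕ.+ t))
        (cong not (trans (cong (λ n → isOdd (n ℕ.+ t)) (sym u+t≡r)) (trans (isOdd-+2* u t) odd))))

    -- The two diagonal laws through (p + 2, r) determine the bottom row recursively.
    x-bottom : ∀ w p → p ℕ.+ w ≡ r → isOdd w ≡ true → x (suc r) (suc p) ≡ - sgn r * e (suc w)
    x-above-bottom : ∀ w p → p ℕ.+ suc w ≡ r → isOdd w ≡ false →
      x r (2 ℕ.+ p) ≡ sgn p * sgn p * (a w * e w) + d (suc w)

    x-bottom (suc w) p refl odd = lemma {sgn p} {X = x (suc r) (suc p)} (sgn² p) sgn-r (B≢0 (suc w) 1)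
      (x-above-bottom w p refl even) (begin
      x r (2 ℕ.+ p)
        ≡⟨ x-antidiagonal-left p (suc w) (ℕ.m≤m+n p (suc w)) odd ⟩
      sgn p * B 1 (suc w) * x (suc r) (suc p) - sgn p * B (suc p) (suc r) * x (suc w) 1
        ≡⟨ cong₂ (λ u v → sgn p * u * x (suc r) (suc p) - sgn p * v * x (suc w) 1) B-1 (B-bottom-odd (suc p) (suc w) refl odd) ⟩
      sgn p * a (suc w) * x (suc r) (suc p) - sgn p * sgn r * x (suc w) 1
        ≡⟨ cong (λ u → sgn p * a (suc w) * x (suc r) (suc p) - sgn p * sgn r * u)
             (x-first-even w (ℕ.m≤n⇒m≤1+n w≤r) even) ⟩
      sgn p * a (suc w) * x (suc r) (suc p) - sgn p * sgn r * c w ∎)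
      where
      open ≡-Reasoning
      even = isOdd-suc⁻¹ w odd
      w≤r : w ≤ r
      w≤r = ℕ.≤-trans (ℕ.n≤1+n w) (ℕ.m≤n+m (suc w) p)
      sgn-r : sgn r ≡ - sgn p
      sgn-r = trans (sgn-+ p (suc w)) (trans (cong (sgn p *_) (sgn-odd (suc w) odd))
        (solve 1 (λ s → s :* :- con 1ℚ := :- s) refl (sgn p)))
      B-1 : B 1 (suc w) ≡ a (suc w)
      B-1 = trans (B-first w w≤r) (trans (cong (_* a (suc w)) (sgn-even w even)) (ℚ.*-identityˡ (a (suc w))))
      -- `f + g` is `c w` and `g + α * e` is `d (suc w)`. As `s * s′` is -1, the common part `f + g`
      -- of the two expressions for `Y` drops out, and the remaining factor `α` can be cancelled.
      lemma : ∀ {s s′ α f g e X Y} → s * s ≡ 1ℚ → s′ ≡ - s → α ≢ 0ℚ →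
        Y ≡ s * s * f + (g + α * e) → Y ≡ s * α * X - s * s′ * (f + g) → X ≡ - s′ * e
      lemma {s} {_} {α} {f} {g} {e} {X} s² refl α≢0 refl eq = *-cancelʳ-≢0 α≢0 (begin
        X * α                                          ≡⟨ ℚ.*-identityˡ (X * α) ⟨
        1ℚ * (X * α)                                   ≡⟨ cong (_* (X * α)) s² ⟨
        s * s * (X * α)
          ≡⟨ solve 5 (λ s α f g X → s :* s :* (X :* α) := s :* (s :* α :* X :- s :* :- s :* (f :+ g) :- s :* s :* (f :+ g)))
               refl s α f g X ⟩
        s * (s * α * X - s * - s * (f + g) - s * s * (f + g)) ≡⟨ cong (λ u → s * (u - s * s * (f + g))) eq ⟨
        s * (s * s * f + (g + α * e) - s * s * (f + g))
          ≡⟨ cong (λ u → s * (u * f + (g + α * e) - u * (f + g))) s² ⟩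
        s * (1ℚ * f + (g + α * e) - 1ℚ * (f + g))
          ≡⟨ solve 5 (λ s α f g e → s :* (con 1ℚ :* f :+ (g :+ α :* e) :- con 1ℚ :* (f :+ g)) := :- (:- s) :* e :* α)
               refl s α f g e ⟩
        - (- s) * e * α                                ∎)

    x-above-bottom zero p refl _ = begin
      x r (2 ℕ.+ p)                              ≡⟨ cong₂ x (ℕ.+-comm p 1) (cong suc (ℕ.+-comm 1 p)) ⟩
      x (suc p) (suc r)                          ≡⟨ x-last p 1 (ℕ.+-comm 1 p) refl ⟩
      d 1
        ≡⟨ solve 3 (λ s α d → d := s :* s :* (α :* con 0ℚ) :+ d) refl (sgn p) (a 0) (d 1) ⟩
      -- The extra term of the general formula vanishes here because `e 0` lies in the zero row.
      sgn p * sgn p * (a 0 * 0ℚ) + d 1           ≡⟨ cong (λ u → sgn p * sgn p * (a 0 * u) + d 1) (x-left 0) ⟨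
      sgn p * sgn p * (a 0 * e 0) + d 1          ∎
      where open ≡-Reasoning
    x-above-bottom (suc w) p p+2+w≡r even = begin
      x r (2 ℕ.+ p)
        ≡⟨ cong (λ n → x n (2 ℕ.+ p)) w+2+p≡r ⟨
      x (w ℕ.+ (2 ℕ.+ p)) (2 ℕ.+ p)
        ≡⟨ x-diagonal-right w (2 ℕ.+ p) (2 ℕ.+ p) 2+p+w≡r parity ⟩
      sgn w * B r (2 ℕ.+ p) * x (suc (w ℕ.+ (2 ℕ.+ p))) (3 ℕ.+ p) - sgn w * B (2 ℕ.+ p) (suc (w ℕ.+ (2 ℕ.+ p))) * D
        ≡⟨ cong (λ n → sgn w * B r (2 ℕ.+ p) * x (suc n) (3 ℕ.+ p) - sgn w * B (2 ℕ.+ p) (suc n) * D) w+2+p≡r ⟩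
      sgn w * B r (2 ℕ.+ p) * x (suc r) (3 ℕ.+ p) - sgn w * B (2 ℕ.+ p) (suc r) * D
        ≡⟨ lemma {s = sgn p} {a (suc w)} {e = e (suc w)} (sgn-odd w odd) (B-last (suc p) (suc w) (trans (ℕ.+-comm (suc w) (suc p)) (trans (cong suc (ℕ.+-suc p w)) 2+p+w≡r)))
             (trans (x-bottom w (2 ℕ.+ p) 2+p+w≡r odd) (cong (λ u → - u * e (suc w)) sgn-r))
             (B-bottom-even (2 ℕ.+ p) (suc w) (trans (ℕ.+-suc (2 ℕ.+ p) w) (cong suc 2+p+w≡r)) even)
             (x-last-next p (2 ℕ.+ w) (trans (ℕ.+-comm (2 ℕ.+ w) p) p+2+w≡r) (trans (isOdd-suc (suc w)) (cong not even))) ⟩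
      sgn p * sgn p * (a (suc w) * e (suc w)) + d (2 ℕ.+ w) ∎
      where
      open ≡-Reasoning
      D = x (2 ℕ.+ p) (suc r)
      odd = isOdd-suc⁻¹ w even
      2+p+w≡r : 2 ℕ.+ p ℕ.+ w ≡ r
      2+p+w≡r = trans (sym (trans (ℕ.+-suc p (suc w)) (cong suc (ℕ.+-suc p w)))) p+2+w≡r
      w+2+p≡r : w ℕ.+ (2 ℕ.+ p) ≡ r
      w+2+p≡r = trans (ℕ.+-comm w (2 ℕ.+ p)) 2+p+w≡r
      parity : isOdd (r ℕ.+ (2 ℕ.+ p)) ≡ true
      parity = trans (cong (λ n → isOdd (n ℕ.+ (2 ℕ.+ p))) (sym w+2+p≡r)) (trans (isOdd-+2* w (2 ℕ.+ p)) odd)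
      sgn-r : sgn r ≡ - sgn p
      sgn-r = trans (cong sgn (sym w+2+p≡r)) (trans (sgn-+ w (2 ℕ.+ p)) (trans (cong (_* sgn (2 ℕ.+ p)) (sgn-odd w odd))
        (solve 1 (λ s → :- con 1ℚ :* :- (:- s) := :- s) refl (sgn p))))
      lemma : ∀ {t b s α X e b′ D D′} → t ≡ - 1ℚ → b ≡ - s * α → X ≡ - (- s) * e → b′ ≡ 1ℚ → D ≡ D′ →
        t * b * X - t * b′ * D ≡ s * s * (α * e) + D′
      lemma {_} {_} {s} {α} {_} {e} {_} {D} refl refl refl refl refl = solve 4 (λ s α e D →
        :- con 1ℚ :* (:- s :* α) :* (:- (:- s) :* e) :- :- con 1ℚ :* con 1ℚ :* D := s :* s :* (α :* e) :+ D) refl s α e D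

-- Total, with value 0 at 0, so that the recursions for values need no nonzeroness proofs in their
-- definitions.
recip : ℚ → ℚ
recip x with x ℚ.≟ 0ℚ
... | yes _ = 0ℚ
... | no x≢0 = (ℚ.1/ x) {{ℚ.≢-nonZero x≢0}}

*-recip : ∀ {x} → x ≢ 0ℚ → x * recip x ≡ 1ℚ
*-recip {x} x≢0 with x ℚ.≟ 0ℚ
... | yes x≡0 = contradiction x≡0 x≢0
... | no x≢0′ = ℚ.*-inverseʳ x {{ℚ.≢-nonZero x≢0′}}

recip≢0 : ∀ {x} → x ≢ 0ℚ → recip x ≢ 0ℚ
recip≢0 {x} x≢0 eq with trans (sym (*-recip x≢0)) (trans (cong (x *_) eq) (ℚ.*-zeroʳ x))
... | ()

neg≢0 : ∀ {x} → x ≢ 0ℚ → - x ≢ 0ℚ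
neg≢0 x≢0 -x≡0 = x≢0 (ℚ.neg-injective -x≡0)

1≢0 : 1ℚ ≢ 0ℚ
1≢0 ()

-- Values of formal fractions

module _ {r : ℕ} (ρ : Vec ℚ r) where

  infix 4 _↝_
  -- The value is given by cross-multiplication. The nonvanishing of the denominator at the point
  -- belongs to the relation; one such point later shows that the denominator is not the zero
  -- polynomial.
  record _↝_ (f : Frac r) (v : ℚ) : Set where
    constructor _,_
    field
      denominator≢0 : ⟦ proj₂ f ⟧ ρ ≢ 0ℚ
      numerator≡ : ⟦ proj₁ f ⟧ ρ ≡ v * ⟦ proj₂ f ⟧ ρ

module _ {r : ℕ} {ρ : Vec ℚ r} where

  private
    infix 4 _⇝_
    _⇝_ = _↝_ ρ

  ↝-0F : 0F ⇝ 0ℚ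
  ↝-0F = 1≢0 , refl

  ↝-1F : 1F ⇝ 1ℚ
  ↝-1F = 1≢0 , refl

  ↝-resp : ∀ {f v w} → v ≡ w → f ⇝ v → f ⇝ w
  ↝-resp refl rep = rep

  ↝-if : ∀ b {f g v w} → f ⇝ v → g ⇝ w → (if b then f else g) ⇝ (if b then v else w)
  ↝-if true f⇝v _ = f⇝v
  ↝-if false _ g⇝w = g⇝w

  ↝-+F : ∀ {f g v w} → f ⇝ v → g ⇝ w → (f +F g) ⇝ (v + w)
  ↝-+F {n , d} {n′ , d′} {v} {w} (d≢0 , n≡) (d′≢0 , n′≡) =
    (λ eq → *-≢0 d≢0 d′≢0 (trans (sym (⊠-hom d d′ ρ)) eq)) , (begin
    ⟦ n ⊠ d′ ⊞ n′ ⊠ d ⟧ ρ                      ≡⟨ ⊞-hom (n ⊠ d′) (n′ ⊠ d) ρ ⟩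
    ⟦ n ⊠ d′ ⟧ ρ + ⟦ n′ ⊠ d ⟧ ρ                ≡⟨ cong₂ _+_ (⊠-hom n d′ ρ) (⊠-hom n′ d ρ) ⟩
    ⟦ n ⟧ ρ * D′ + ⟦ n′ ⟧ ρ * D                ≡⟨ cong₂ (λ x y → x * D′ + y * D) n≡ n′≡ ⟩
    v * D * D′ + w * D′ * D
      ≡⟨ solve 4 (λ v w D D′ → v :* D :* D′ :+ w :* D′ :* D := (v :+ w) :* (D :* D′)) refl v w D D′ ⟩
    (v + w) * (D * D′)                         ≡⟨ cong ((v + w) *_) (⊠-hom d d′ ρ) ⟨
    (v + w) * ⟦ d ⊠ d′ ⟧ ρ                     ∎)
    where
    open ≡-Reasoning
    D = ⟦ d ⟧ ρ
    D′ = ⟦ d′ ⟧ ρ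

  ↝-*F : ∀ {f g v w} → f ⇝ v → g ⇝ w → (f *F g) ⇝ (v * w)
  ↝-*F {n , d} {n′ , d′} {v} {w} (d≢0 , n≡) (d′≢0 , n′≡) =
    (λ eq → *-≢0 d≢0 d′≢0 (trans (sym (⊠-hom d d′ ρ)) eq)) , (begin
    ⟦ n ⊠ n′ ⟧ ρ                ≡⟨ ⊠-hom n n′ ρ ⟩
    ⟦ n ⟧ ρ * ⟦ n′ ⟧ ρ          ≡⟨ cong₂ _*_ n≡ n′≡ ⟩
    (v * D) * (w * D′)          ≡⟨ solve 4 (λ v w D D′ → v :* D :* (w :* D′) := v :* w :* (D :* D′)) refl v w D D′ ⟩
    v * w * (D * D′)            ≡⟨ cong (v * w *_) (⊠-hom d d′ ρ) ⟨
    v * w * ⟦ d ⊠ d′ ⟧ ρ        ∎)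
    where
    open ≡-Reasoning
    D = ⟦ d ⟧ ρ
    D′ = ⟦ d′ ⟧ ρ

  ↝-/F : ∀ {f g v w} → f ⇝ v → g ⇝ w → w ≢ 0ℚ → (f /F g) ⇝ (v * recip w)
  ↝-/F {n , d} {n′ , d′} {v} {w} (d≢0 , n≡) (d′≢0 , n′≡) w≢0 =
    (λ eq → *-≢0 d≢0 (λ n′≡0 → *-≢0 w≢0 d′≢0 (trans (sym n′≡) n′≡0)) (trans (sym (⊠-hom d n′ ρ)) eq)) , (begin
    ⟦ n ⊠ d′ ⟧ ρ                   ≡⟨ ⊠-hom n d′ ρ ⟩
    ⟦ n ⟧ ρ * D′                   ≡⟨ cong (_* D′) n≡ ⟩
    v * D * D′                     ≡⟨ solve 3 (λ v D D′ → v :* D :* D′ := v :* D :* D′ :* con 1ℚ) refl v D D′ ⟩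
    v * D * D′ * 1ℚ                ≡⟨ cong (v * D * D′ *_) (*-recip w≢0) ⟨
    v * D * D′ * (w * recip w)
      ≡⟨ solve 5 (λ v w w⁻¹ D D′ → v :* D :* D′ :* (w :* w⁻¹) := v :* w⁻¹ :* (D :* (w :* D′)))
           refl v w (recip w) D D′ ⟩
    v * recip w * (D * (w * D′))   ≡⟨ cong (λ x → v * recip w * (D * x)) n′≡ ⟨
    v * recip w * (D * ⟦ n′ ⟧ ρ)   ≡⟨ cong (v * recip w *_) (⊠-hom d n′ ρ) ⟨
    v * recip w * ⟦ d ⊠ n′ ⟧ ρ     ∎)
    where
    open ≡-Reasoning
    D = ⟦ d ⟧ ρ
    D′ = ⟦ d′ ⟧ ρ

  ↝--F : ∀ {f v} → f ⇝ v → (-F f) ⇝ (- v)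
  ↝--F {n , d} {v} (d≢0 , n≡) = d≢0 ,
    trans (⊟-hom n ρ) (trans (cong -_ n≡) (ℚ.neg-distribˡ-* v (⟦ d ⟧ ρ)))

  ↝-sumFin : ∀ n {f : Fin n → Frac r} {v : Fin n → ℚ} → (∀ k → f k ⇝ v k) → sumFin n f ⇝ sum v
  ↝-sumFin zero rep = ↝-0F
  ↝-sumFin (suc n) {v = v} rep = ↝-+F {v = v Fin.zero} {w = sum {n} (v ∘ Fin.suc)} (rep Fin.zero) (↝-sumFin n (rep ∘ Fin.suc))

-- Matrices and vectors with 1-based indices in ℕ, of which only 1, …, r + 1 matter

δ : ℕ → ℕ → ℚ
δ p q = if p ≡ᵇ q then 1ℚ else 0ℚ

blockℚ : ℕ → ℚ → ℚ → ℚ → ℚ → ℕ → ℕ → ℚ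
blockℚ i e₁₁ e₁₂ e₂₁ e₂₂ p q =
  if (p ≡ᵇ i) ∧ (q ≡ᵇ i) then e₁₁ else
  if (p ≡ᵇ i) ∧ (q ≡ᵇ suc i) then e₁₂ else
  if (p ≡ᵇ suc i) ∧ (q ≡ᵇ i) then e₂₁ else
  if (p ≡ᵇ suc i) ∧ (q ≡ᵇ suc i) then e₂₂ else
  δ p q

≡ᵇ-refl : ∀ n → (n ≡ᵇ n) ≡ true
≡ᵇ-refl zero = refl
≡ᵇ-refl (suc n) = ≡ᵇ-refl n

≢⇒≡ᵇ-false : ∀ m n → m ≢ n → (m ≡ᵇ n) ≡ false
≢⇒≡ᵇ-false zero zero m≢n = contradiction refl m≢n
≢⇒≡ᵇ-false zero (suc n) m≢n = refl
≢⇒≡ᵇ-false (suc m) zero m≢n = refl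
≢⇒≡ᵇ-false (suc m) (suc n) m≢n = ≢⇒≡ᵇ-false m n (m≢n ∘ cong suc)

sum-zero : ∀ n {f : Fin n → ℚ} → (∀ k → f k ≡ 0ℚ) → sum f ≡ 0ℚ
sum-zero zero f≗0 = refl
sum-zero (suc n) f≗0 = cong₂ _+_ (f≗0 Fin.zero) (sum-zero n (f≗0 ∘ Fin.suc))

sum-δ : ∀ n N (g : ℕ → ℚ) → n < N → sum {N} (λ k → δ n (toℕ k) * g (toℕ k)) ≡ g n
sum-δ zero (suc N) g _ = trans (cong (1ℚ * g 0 +_) (sum-zero N (λ k → ℚ.*-zeroˡ (g (suc (toℕ k))))))
  (trans (ℚ.+-identityʳ _) (ℚ.*-identityˡ (g 0)))
sum-δ (suc n) (suc N) g (s≤s n<N) = trans (cong₂ _+_ (ℚ.*-zeroˡ (g 0)) (sum-δ n N (g ∘ suc) n<N)) (ℚ.+-identityˡ _)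

module _ (r : ℕ) where

  apply : (ℕ → ℕ → ℚ) → (ℕ → ℚ) → ℕ → ℚ
  apply μ v p = sum {suc r} (λ k → μ p (suc (toℕ k)) * v (suc (toℕ k)))

  _∙_ : (ℕ → ℕ → ℚ) → (ℕ → ℕ → ℚ) → ℕ → ℕ → ℚ
  (μ ∙ ν) p q = apply μ (λ k → ν k q) p

  apply-∙ : ∀ μ ν v p → apply (μ ∙ ν) v p ≡ apply μ (apply ν v) p
  apply-∙ μ ν v p = begin
    sum {suc r} (λ k → sum {suc r} (λ l → μ p (suc (toℕ l)) * ν (suc (toℕ l)) (suc (toℕ k))) * v (suc (toℕ k)))
      ≡⟨ sum-cong-≗ {suc r} (λ k → *-distribʳ-sum {suc r} (v (suc (toℕ k))) (λ l → μ p (suc (toℕ l)) * ν (suc (toℕ l)) (suc (toℕ k)))) ⟩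
    sum {suc r} (λ k → sum {suc r} (λ l → μ p (suc (toℕ l)) * ν (suc (toℕ l)) (suc (toℕ k)) * v (suc (toℕ k))))
      ≡⟨ ∑-comm {suc r} {suc r} (λ k l → μ p (suc (toℕ l)) * ν (suc (toℕ l)) (suc (toℕ k)) * v (suc (toℕ k))) ⟩
    sum {suc r} (λ l → sum {suc r} (λ k → μ p (suc (toℕ l)) * ν (suc (toℕ l)) (suc (toℕ k)) * v (suc (toℕ k))))
      ≡⟨ sum-cong-≗ {suc r} (λ l → trans (sum-cong-≗ {suc r} (λ k → ℚ.*-assoc (μ p (suc (toℕ l))) (ν (suc (toℕ l)) (suc (toℕ k))) (v (suc (toℕ k)))))
           (sym (*-distribˡ-sum {suc r} (μ p (suc (toℕ l))) (λ k → ν (suc (toℕ l)) (suc (toℕ k)) * v (suc (toℕ k)))))) ⟩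
    sum {suc r} (λ l → μ p (suc (toℕ l)) * sum {suc r} (λ k → ν (suc (toℕ l)) (suc (toℕ k)) * v (suc (toℕ k)))) ∎
    where open ≡-Reasoning

  apply-δ : ∀ v p → p ≤ r → apply δ v (suc p) ≡ v (suc p)
  apply-δ v p p≤r = sum-δ p (suc r) (v ∘ suc) (s≤s p≤r)

  apply-two : ∀ μ v p i {α β} → i < r →
    (∀ q → μ p q ≡ α * δ (suc i) q + β * δ (2 ℕ.+ i) q) →
    apply μ v p ≡ α * v (suc i) + β * v (2 ℕ.+ i)
  apply-two μ v p i {α} {β} i<r μp≗ = begin
    sum {suc r} (λ k → μ p (suc (toℕ k)) * v (suc (toℕ k)))
      ≡⟨ sum-cong-≗ {suc r} (λ k → trans (cong (_* v (suc (toℕ k))) (μp≗ (suc (toℕ k))))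
           (solve 5 (λ α β x y v → (α :* x :+ β :* y) :* v := α :* (x :* v) :+ β :* (y :* v)) refl
             α β (δ i (toℕ k)) (δ (suc i) (toℕ k)) (v (suc (toℕ k))))) ⟩
    sum {suc r} (λ k → α * f k + β * g k)
      ≡⟨ ∑-distrib-+ {suc r} (λ k → α * f k) (λ k → β * g k) ⟩
    sum {suc r} (λ k → α * f k) + sum {suc r} (λ k → β * g k)
      ≡⟨ cong₂ _+_ (*-distribˡ-sum {suc r} α f) (*-distribˡ-sum {suc r} β g) ⟨
    α * sum f + β * sum g
      ≡⟨ cong₂ (λ x y → α * x + β * y) (sum-δ i (suc r) (v ∘ suc) (ℕ.m<n⇒m<1+n i<r)) (sum-δ (suc i) (suc r) (v ∘ suc) (s≤s i<r)) ⟩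
    α * v (suc i) + β * v (2 ℕ.+ i) ∎
    where
    open ≡-Reasoning
    f g : Fin (suc r) → ℚ
    f k = δ i (toℕ k) * v (suc (toℕ k))
    g k = δ (suc i) (toℕ k) * v (suc (toℕ k))

  module _ (i : ℕ) (e₁₁ e₁₂ e₂₁ e₂₂ : ℚ) where

    private
      M = blockℚ (suc i) e₁₁ e₁₂ e₂₁ e₂₂

    two-δ : ∀ α β q →
      (if q ≡ᵇ suc i then α else if q ≡ᵇ 2 ℕ.+ i then β else 0ℚ) ≡ α * δ (suc i) q + β * δ (2 ℕ.+ i) q
    two-δ α β q with q ℕ.≟ suc i
    ... | yes refl rewrite ≡ᵇ-refl i | ≢⇒≡ᵇ-false (suc i) i ℕ.1+n≢n = solve 2 (λ α β → α := α :* con 1ℚ :+ β :* con 0ℚ) refl α β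
    ... | no q≢1+i rewrite ≢⇒≡ᵇ-false q (suc i) q≢1+i | ≢⇒≡ᵇ-false (suc i) q (q≢1+i ∘ sym) with q ℕ.≟ 2 ℕ.+ i
    ... | yes refl rewrite ≡ᵇ-refl i = solve 2 (λ α β → β := α :* con 0ℚ :+ β :* con 1ℚ) refl α β
    ... | no q≢2+i rewrite ≢⇒≡ᵇ-false q (2 ℕ.+ i) q≢2+i | ≢⇒≡ᵇ-false (2 ℕ.+ i) q (q≢2+i ∘ sym) =
      solve 2 (λ α β → con 0ℚ := α :* con 0ℚ :+ β :* con 0ℚ) refl α β

    apply-block-upper : ∀ v → i < r → apply M v (suc i) ≡ e₁₁ * v (suc i) + e₁₂ * v (2 ℕ.+ i)
    apply-block-upper v i<r = apply-two M v (suc i) i {e₁₁} {e₁₂} i<r row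
      where
      row : ∀ q → M (suc i) q ≡ e₁₁ * δ (suc i) q + e₁₂ * δ (2 ℕ.+ i) q
      row q rewrite ≡ᵇ-refl i | ≢⇒≡ᵇ-false i (suc i) (ℕ.1+n≢n ∘ sym) = trans vanish (two-δ e₁₁ e₁₂ q)
        where
        vanish : (if q ≡ᵇ suc i then e₁₁ else if q ≡ᵇ 2 ℕ.+ i then e₁₂ else δ (suc i) q) ≡
                 (if q ≡ᵇ suc i then e₁₁ else if q ≡ᵇ 2 ℕ.+ i then e₁₂ else 0ℚ)
        vanish with q ℕ.≟ suc i
        ... | yes refl rewrite ≡ᵇ-refl i = refl
        ... | no q≢1+i rewrite ≢⇒≡ᵇ-false (suc i) q (q≢1+i ∘ sym) = refl

    apply-block-lower : ∀ v → i < r → apply M v (2 ℕ.+ i) ≡ e₂₁ * v (suc i) + e₂₂ * v (2 ℕ.+ i)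
    apply-block-lower v i<r = apply-two M v (2 ℕ.+ i) i {e₂₁} {e₂₂} i<r row
      where
      row : ∀ q → M (2 ℕ.+ i) q ≡ e₂₁ * δ (suc i) q + e₂₂ * δ (2 ℕ.+ i) q
      row q rewrite ≡ᵇ-refl i | ≢⇒≡ᵇ-false (suc i) i ℕ.1+n≢n = trans vanish (two-δ e₂₁ e₂₂ q)
        where
        vanish : (if q ≡ᵇ suc i then e₂₁ else if q ≡ᵇ 2 ℕ.+ i then e₂₂ else δ (2 ℕ.+ i) q) ≡
                 (if q ≡ᵇ suc i then e₂₁ else if q ≡ᵇ 2 ℕ.+ i then e₂₂ else 0ℚ)
        vanish with q ℕ.≟ 2 ℕ.+ i
        ... | yes refl rewrite ≡ᵇ-refl i | ≢⇒≡ᵇ-false (suc i) i ℕ.1+n≢n = refl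
        ... | no q≢2+i rewrite ≢⇒≡ᵇ-false (2 ℕ.+ i) q (q≢2+i ∘ sym) = refl

    apply-block-other : ∀ v p → p ≤ r → p ≢ i → p ≢ suc i → apply M v (suc p) ≡ v (suc p)
    apply-block-other v p p≤r p≢i p≢1+i =
      trans (sum-cong-≗ {suc r} (λ k → cong (_* v (suc (toℕ k))) (row (suc (toℕ k))))) (apply-δ v p p≤r)
      where
      row : ∀ q → M (suc p) q ≡ δ (suc p) q
      row q rewrite ≢⇒≡ᵇ-false p i p≢i | ≢⇒≡ᵇ-false p (suc i) p≢1+i = refl

-- Values of the array and of the matrix products at a point

≤⇒<ᵇ-false : ∀ {m n} → n ≤ m → (m <ᵇ n) ≡ false
≤⇒<ᵇ-false z≤n = refl
≤⇒<ᵇ-false (s≤s n≤m) = ≤⇒<ᵇ-false n≤m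

<⇒<ᵇ-true : ∀ {m n} → m < n → (m <ᵇ n) ≡ true
<⇒<ᵇ-true {zero} (s≤s _) = refl
<⇒<ᵇ-true {suc m} (s≤s m<n) = <⇒<ᵇ-true m<n

recip-1 : ∀ {x y z} → x ≡ 1ℚ → y ≡ z → y * recip x ≡ z
recip-1 {y = y} refl refl = ℚ.*-identityʳ y

Var≢0 : ∀ r {ρ : Vec ℚ r} → All (_≢ 0ℚ) ρ → ∀ i → ⟦ Var r i ⟧ ρ ≢ 0ℚ
Var≢0 zero _ i = 1≢0
Var≢0 (suc r) {ρ} ρ≢0 i eq = All.lookup ρ≢0 (∈-lookup (clampFin r (i ∸ 1)) ρ) (trans (sym (ι-hom (clampFin r (i ∸ 1)) ρ)) eq)

module Values {r : ℕ} (ρ : Vec ℚ r) where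

  row1ℚ : ℕ → ℚ
  row1ℚ i = if edge r i then 1ℚ else ⟦ Var r i ⟧ ρ

  stepℚ : (ℕ → ℚ) → (ℕ → ℚ) → ℕ → ℚ
  stepℚ prev cur i = if edge r i then 1ℚ else - (cur (i ∸ 1) * cur (suc i)) * recip (prev i)

  rowsℚ : ℕ → (ℕ → ℚ) × (ℕ → ℚ)
  rowsℚ zero = (λ _ → 1ℚ) , row1ℚ
  rowsℚ (suc t) = proj₂ (rowsℚ t) , stepℚ (proj₁ (rowsℚ t)) (proj₂ (rowsℚ t))

  B : ℕ → ℕ → ℚ
  B p t = proj₁ (rowsℚ t) p

  -- vpart is row p + 1 after the factor V_{p+1} alone, upart after U_p as well.
  vpart : ℕ → (ℕ → ℚ) → ℕ → ℚ
  vpart m v p = if isOdd (p ℕ.+ m)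
    then B (suc p) (suc m) * recip (B (suc p) m) * v (suc p) + B p m * recip (B (suc p) m) * v (2 ℕ.+ p)
    else v (suc p)

  upart : ℕ → (ℕ → ℚ) → ℕ → ℚ
  upart m v p = if isOdd (p ℕ.+ m)
    then B (suc p) (suc m) * recip (B p m) * v p + B p (suc m) * recip (B p m) * vpart m v p
    else v (suc p)

  nextRow : ℕ → (ℕ → ℚ) → ℕ → ℚ
  nextRow m v zero = 0ℚ
  nextRow m v (suc p) = if r <ᵇ p then 0ℚ else upart m v p

  x : Fin (suc r) → ℕ → ℕ → ℚ
  x q zero p = δ p (suc (toℕ q))
  x q (suc t) p = nextRow t (x q t) p

  Nℚ : ℕ → ℕ → ℕ → ℕ → ℚ
  Nℚ m i = if isOdd (i ℕ.+ m)
    then blockℚ i 1ℚ 0ℚ (B (suc i) (suc m) * recip (B i m)) (B i (suc m) * recip (B i m))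
    else blockℚ i (B i (suc m) * recip (B i m)) (B (i ∸ 1) m * recip (B i m)) 0ℚ 1ℚ

  rowProdℚ : ℕ → List ℕ → ℕ → ℕ → ℚ
  rowProdℚ m = foldr (λ i M → _∙_ r (Nℚ m i) M) δ

  module _ (ρ≢0 : All (_≢ 0ℚ) ρ) where

    private
      -- Nonvanishing travels with the values because each entry becomes a divisor two levels later.
      Good : (ℕ → Frac r) → (ℕ → ℚ) → Set
      Good f v = ∀ i → _↝_ ρ (f i) (v i) × v i ≢ 0ℚ

    row1-good : Good (row1 r) row1ℚ
    row1-good i with edge r i
    ... | true = ↝-1F , 1≢0
    ... | false = (1≢0 , sym (ℚ.*-identityʳ _)) , Var≢0 r ρ≢0 i

    step-good : ∀ {f g v w} → Good f v → Good g w → Good (step r f g) (stepℚ v w)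
    step-good {f} {g} {v} {w} f↝v g↝w i with edge r i
    ... | true = ↝-1F , 1≢0
    ... | false = ↝-/F {v = - (w (i ∸ 1) * w (suc i))} {w = v i}
        (↝--F {v = w (i ∸ 1) * w (suc i)} (↝-*F {v = w (i ∸ 1)} {w = w (suc i)} (proj₁ (g↝w (i ∸ 1))) (proj₁ (g↝w (suc i)))))
        (proj₁ (f↝v i)) (proj₂ (f↝v i))
      , *-≢0 (neg≢0 (*-≢0 (proj₂ (g↝w (i ∸ 1))) (proj₂ (g↝w (suc i))))) (recip≢0 (proj₂ (f↝v i)))

    rows-good : ∀ t → Good (proj₁ (rows r t)) (proj₁ (rowsℚ t)) × Good (proj₂ (rows r t)) (proj₂ (rowsℚ t))
    rows-good zero = (λ _ → ↝-1F , 1≢0) , row1-good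
    rows-good (suc t) with rows-good t
    ... | prev , cur = cur , step-good prev cur

    A↝B : ∀ p t → _↝_ ρ (A r p t) (B p t)
    A↝B p t = proj₁ (proj₁ (rows-good t) p)

    B≢0 : ∀ p t → B p t ≢ 0ℚ
    B≢0 p t = proj₂ (proj₁ (rows-good t) p)

    B-left : ∀ t → B 0 t ≡ 1ℚ
    B-left zero = refl
    B-left (suc zero) = refl
    B-left (suc (suc t)) = refl

    B-right : ∀ t → B (suc r) t ≡ 1ℚ
    B-right zero = refl
    B-right (suc zero) rewrite <⇒<ᵇ-true (ℕ.n<1+n r) = refl
    B-right (suc (suc t)) rewrite <⇒<ᵇ-true (ℕ.n<1+n r) = refl

    B-step : ∀ p t → p < r → B (suc p) (2 ℕ.+ t) * B (suc p) t ≡ - (B p (suc t) * B (2 ℕ.+ p) (suc t))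
    B-step p t p<r rewrite ≤⇒<ᵇ-false p<r = begin
      - b * recip z * z     ≡⟨ solve 3 (λ b i z → :- b :* i :* z := :- b :* (z :* i)) refl b (recip z) z ⟩
      - b * (z * recip z)   ≡⟨ cong (- b *_) (*-recip (B≢0 (suc p) t)) ⟩
      - b * 1ℚ              ≡⟨ ℚ.*-identityʳ (- b) ⟩
      - b                   ∎
      where
      open ≡-Reasoning
      b = B p (suc t) * B (2 ℕ.+ p) (suc t)
      z = B (suc p) t

    module _ (q : Fin (suc r)) where

      x-left : ∀ t → x q t 0 ≡ 0ℚ
      x-left zero = refl
      x-left (suc t) = refl

      x-right : ∀ t → x q t (2 ℕ.+ r) ≡ 0ℚ
      x-right zero rewrite ≢⇒≡ᵇ-false (suc r) (toℕ q) (λ eq → ℕ.<⇒≢ (Fin.toℕ<n q) (sym eq)) = refl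
      x-right (suc t) rewrite <⇒<ᵇ-true (ℕ.n<1+n r) = refl

      -- For this parity the adjacent factors are V_p and U_{p+1}, which rewrite rows p and p + 2.
      x-same : ∀ m p → p ≤ r → isOdd (p ℕ.+ m) ≡ false → x q (suc m) (suc p) ≡ x q m (suc p)
      x-same m p p≤r even rewrite ≤⇒<ᵇ-false p≤r | even = refl

      -- For this parity V_{p+1} and then U_p act on row p + 1. Multiplying their composite by the
      -- two divisors `B p m` and `B (suc p) m` frees the analysis of the rows from reciprocals.
      x-step : ∀ m p → p ≤ r → isOdd (p ℕ.+ m) ≡ true →
        B p m * B (suc p) m * x q (suc m) (suc p) ≡
          B (suc p) (suc m) * B (suc p) m * x q m p
          + B p (suc m) * B (suc p) (suc m) * x q m (suc p)
          + B p (suc m) * B p m * x q m (2 ℕ.+ p)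
      x-step m p p≤r odd rewrite ≤⇒<ᵇ-false p≤r | odd =
        lemma {B p m} {B (suc p) m} {B p (suc m)} {B (suc p) (suc m)} (*-recip (B≢0 p m)) (*-recip (B≢0 (suc p) m))
        where
        open ≡-Reasoning
        lemma : ∀ {P Q P′ Q′ P⁻¹ Q⁻¹ x₀ x₁ x₂} → P * P⁻¹ ≡ 1ℚ → Q * Q⁻¹ ≡ 1ℚ →
          P * Q * (Q′ * P⁻¹ * x₀ + P′ * P⁻¹ * (Q′ * Q⁻¹ * x₁ + P * Q⁻¹ * x₂)) ≡
          Q′ * Q * x₀ + P′ * Q′ * x₁ + P′ * P * x₂
        lemma {P} {Q} {P′} {Q′} {P⁻¹} {Q⁻¹} {x₀} {x₁} {x₂} PP⁻¹ QQ⁻¹ = begin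
          P * Q * (Q′ * P⁻¹ * x₀ + P′ * P⁻¹ * (Q′ * Q⁻¹ * x₁ + P * Q⁻¹ * x₂))
            ≡⟨ solve 9 (λ P Q P′ Q′ P⁻¹ Q⁻¹ x₀ x₁ x₂ →
                 P :* Q :* (Q′ :* P⁻¹ :* x₀ :+ P′ :* P⁻¹ :* (Q′ :* Q⁻¹ :* x₁ :+ P :* Q⁻¹ :* x₂)) :=
                 (P :* P⁻¹) :* (Q′ :* Q :* x₀ :+ (Q :* Q⁻¹) :* (P′ :* Q′ :* x₁ :+ P′ :* P :* x₂)))
                 refl P Q P′ Q′ P⁻¹ Q⁻¹ x₀ x₁ x₂ ⟩
          (P * P⁻¹) * (Q′ * Q * x₀ + (Q * Q⁻¹) * (P′ * Q′ * x₁ + P′ * P * x₂))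
            ≡⟨ cong₂ (λ u v → u * (Q′ * Q * x₀ + v * (P′ * Q′ * x₁ + P′ * P * x₂))) PP⁻¹ QQ⁻¹ ⟩
          1ℚ * (Q′ * Q * x₀ + 1ℚ * (P′ * Q′ * x₁ + P′ * P * x₂))
            ≡⟨ solve 3 (λ u v w → con 1ℚ :* (u :+ con 1ℚ :* (v :+ w)) := u :+ v :+ w)
                 refl (Q′ * Q * x₀) (P′ * Q′ * x₁) (P′ * P * x₂) ⟩
          Q′ * Q * x₀ + P′ * Q′ * x₁ + P′ * P * x₂ ∎

    RepresentedBy : Mat r → (ℕ → ℕ → ℚ) → Set
    RepresentedBy M μ = ∀ p q → _↝_ ρ (M p q) (μ (suc (toℕ p)) (suc (toℕ q)))

    ·-represented : ∀ {M N μ ν} → RepresentedBy M μ → RepresentedBy N ν → RepresentedBy (M · N) (_∙_ r μ ν)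
    ·-represented {μ = μ} {ν} M↝ N↝ p q = ↝-sumFin (suc r) (λ k →
      ↝-*F {v = μ (suc (toℕ p)) (suc (toℕ k))} {w = ν (suc (toℕ k)) (suc (toℕ q))} (M↝ p k) (N↝ k q))

    Id-represented : RepresentedBy (Id r) δ
    Id-represented p q = ↝-if (toℕ p ≡ᵇ toℕ q) ↝-1F ↝-0F

    block-represented : ∀ i {f₁₁ f₁₂ f₂₁ f₂₂ e₁₁ e₁₂ e₂₁ e₂₂} → _↝_ ρ f₁₁ e₁₁ → _↝_ ρ f₁₂ e₁₂ → _↝_ ρ f₂₁ e₂₁ → _↝_ ρ f₂₂ e₂₂ →
      RepresentedBy (block r i f₁₁ f₁₂ f₂₁ f₂₂) (blockℚ i e₁₁ e₁₂ e₂₁ e₂₂)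
    block-represented i r₁₁ r₁₂ r₂₁ r₂₂ p q =
      ↝-if ((suc (toℕ p) ≡ᵇ i) ∧ (suc (toℕ q) ≡ᵇ i)) r₁₁
      (↝-if ((suc (toℕ p) ≡ᵇ i) ∧ (suc (toℕ q) ≡ᵇ suc i)) r₁₂
      (↝-if ((suc (toℕ p) ≡ᵇ suc i) ∧ (suc (toℕ q) ≡ᵇ i)) r₂₁
      (↝-if ((suc (toℕ p) ≡ᵇ suc i) ∧ (suc (toℕ q) ≡ᵇ suc i)) r₂₂ (Id-represented p q))))

    N-represented : ∀ m i → RepresentedBy (N r i m) (Nℚ m i)
    N-represented m i with isOdd (i ℕ.+ m)
    ... | true = block-represented i ↝-1F ↝-0F
      (↝-/F {v = B (suc i) (suc m)} (A↝B (suc i) (suc m)) (A↝B i m) (B≢0 i m))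
      (↝-/F {v = B i (suc m)} (A↝B i (suc m)) (A↝B i m) (B≢0 i m))
    ... | false = block-represented i
      (↝-/F {v = B i (suc m)} (A↝B i (suc m)) (A↝B i m) (B≢0 i m))
      (↝-/F {v = B (i ∸ 1) m} (A↝B (i ∸ 1) m) (A↝B i m) (B≢0 i m)) ↝-0F ↝-1F

    rowProd-represented : ∀ m is → RepresentedBy (foldr (λ i M → N r i m · M) (Id r) is) (rowProdℚ m is)
    rowProd-represented m [] = Id-represented
    rowProd-represented m (i ∷ is) = ·-represented {μ = Nℚ m i} {rowProdℚ m is} (N-represented m i) (rowProd-represented m is)

    apply-N-odd : ∀ m i v → i < r → isOdd (suc i ℕ.+ m) ≡ true →
      apply r (Nℚ m (suc i)) v (2 ℕ.+ i) ≡
        B (2 ℕ.+ i) (suc m) * recip (B (suc i) m) * v (suc i) + B (suc i) (suc m) * recip (B (suc i) m) * v (2 ℕ.+ i)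
    apply-N-odd m i v i<r odd rewrite odd = apply-block-lower r i _ _ _ _ v i<r

    apply-N-odd-other : ∀ m i v p → p ≤ r → p ≢ suc i → i < r → isOdd (suc i ℕ.+ m) ≡ true →
      apply r (Nℚ m (suc i)) v (suc p) ≡ v (suc p)
    apply-N-odd-other m i v p p≤r p≢1+i i<r odd rewrite odd with p ℕ.≟ i
    ... | yes refl = trans (apply-block-upper r i _ _ _ _ v i<r)
      (solve 2 (λ x y → con 1ℚ :* x :+ con 0ℚ :* y := x) refl (v (suc i)) (v (2 ℕ.+ i)))
    ... | no p≢i = apply-block-other r i _ _ _ _ v p p≤r p≢i p≢1+i

    apply-N-even : ∀ m i v → i < r → isOdd (suc i ℕ.+ m) ≡ false →
      apply r (Nℚ m (suc i)) v (suc i) ≡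
        B (suc i) (suc m) * recip (B (suc i) m) * v (suc i) + B i m * recip (B (suc i) m) * v (2 ℕ.+ i)
    apply-N-even m i v i<r even rewrite even = apply-block-upper r i _ _ _ _ v i<r

    apply-N-even-other : ∀ m i v p → p ≤ r → p ≢ i → i < r → isOdd (suc i ℕ.+ m) ≡ false →
      apply r (Nℚ m (suc i)) v (suc p) ≡ v (suc p)
    apply-N-even-other m i v p p≤r p≢i i<r even rewrite even with p ℕ.≟ suc i
    ... | yes refl = trans (apply-block-lower r i _ _ _ _ v i<r)
      (solve 2 (λ x y → con 0ℚ :* x :+ con 1ℚ :* y := y) refl (v (suc i)) (v (2 ℕ.+ i)))
    ... | no p≢1+i = apply-block-other r i _ _ _ _ v p p≤r p≢i p≢1+i

    module _ (m : ℕ) (v : ℕ → ℚ) (v-left : v 0 ≡ 0ℚ) (v-right : v (2 ℕ.+ r) ≡ 0ℚ) where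

      vpart-even : ∀ p → isOdd (p ℕ.+ m) ≡ false → vpart m v p ≡ v (suc p)
      vpart-even p even rewrite even = refl

      upart-even : ∀ p → isOdd (p ℕ.+ m) ≡ false → upart m v p ≡ v (suc p)
      upart-even p even rewrite even = refl

      vpart-odd : ∀ p → isOdd (p ℕ.+ m) ≡ true → vpart m v p ≡
        B (suc p) (suc m) * recip (B (suc p) m) * v (suc p) + B p m * recip (B (suc p) m) * v (2 ℕ.+ p)
      vpart-odd p odd rewrite odd = refl

      upart-odd : ∀ p → isOdd (p ℕ.+ m) ≡ true → upart m v p ≡
        B (suc p) (suc m) * recip (B p m) * v p + B p (suc m) * recip (B p m) * vpart m v p
      upart-odd p odd rewrite odd = refl

      -- There is no factor V_{r+1}. The formula for it acts as the identity, by the zero row r + 2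
      -- and the edge values 1.
      vpart-last : vpart m v r ≡ v (suc r)
      vpart-last with isOdd (r ℕ.+ m)
      ... | false = refl
      ... | true = lemma {β = B r m * recip (B (suc r) m)} (recip-1 (B-right m) (B-right (suc m))) v-right
        where
        lemma : ∀ {α β y z} → α ≡ 1ℚ → z ≡ 0ℚ → α * y + β * z ≡ y
        lemma {_} {β} {y} refl refl = solve 2 (λ y β → con 1ℚ :* y :+ β :* con 0ℚ := y) refl y β

      -- Likewise there is no factor U_0, and the zero row 0 makes its formula harmless.
      vpart-first : vpart m v 0 ≡ upart m v 0
      vpart-first with isOdd m in parity
      ... | false = refl
      ... | true = sym (lemma {α = B 1 (suc m) * recip (B 0 m)} v-left (recip-1 (B-left m) (B-left (suc m))))
        where
        lemma : ∀ {α β y z} → z ≡ 0ℚ → β ≡ 1ℚ → α * z + β * y ≡ y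
        lemma {α} {_} {y} refl refl = solve 2 (λ α y → α :* con 0ℚ :+ con 1ℚ :* y := y) refl α y

      -- The product N_{k+1} ⋯ N_r leaves rows ≤ k alone, has finished rows > k + 1,
      -- and row k + 1 still lacks the factor U_k.
      rowProd-action : ∀ n k f → (∀ i → f i ≡ k ℕ.+ i) → k ℕ.+ n ≡ r →
        let w = apply r (rowProdℚ m (map suc (applyUpTo f n))) v in
        (∀ p → p < k → w (suc p) ≡ v (suc p)) ×
        w (suc k) ≡ vpart m v k ×
        (∀ p → k < p → p ≤ r → w (suc p) ≡ upart m v p)
      rowProd-action zero k f _ k+0≡r with trans (sym (ℕ.+-identityʳ k)) k+0≡r
      ... | refl = (λ p p<r → apply-δ r v p (ℕ.<⇒≤ p<r)) , trans (apply-δ r v r ℕ.≤-refl) (sym vpart-last) ,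
        λ p r<p p≤r → contradiction p≤r (ℕ.<⇒≱ r<p)
      -- `applyUpTo` recurses by precomposing `f` with `suc`, so `f` is only known pointwise and
      -- `f 0` has to be abstracted before it can become `k`.
      rowProd-action (suc n) k f f≗ k+n≡r
        with f 0 | trans (f≗ 0) (ℕ.+-identityʳ k) | rowProd-action n (suc k) (f ∘ suc) (λ i → trans (f≗ (suc i)) (ℕ.+-suc k i)) (trans (sym (ℕ.+-suc k n)) k+n≡r)
      ... | _ | refl | below , at , above = first , second , third
        where
        w = apply r (rowProdℚ m (map suc (applyUpTo (f ∘ suc) n))) v
        k<r : k < r
        k<r = subst (k <_) k+n≡r (ℕ.m<m+n k (s≤s z≤n))
        split : ∀ p → apply r (rowProdℚ m (suc k ∷ map suc (applyUpTo (f ∘ suc) n))) v p ≡ apply r (Nℚ m (suc k)) w p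
        split p = apply-∙ r (Nℚ m (suc k)) (rowProdℚ m (map suc (applyUpTo (f ∘ suc) n))) v p
        other : ∀ p → p < k → p ≢ suc k
        other p p<k = ℕ.<⇒≢ (ℕ.m<n⇒m<1+n p<k)
        below-at : w (suc k) ≡ v (suc k)
        below-at = below k (ℕ.n<1+n k)
        first : ∀ p → p < k → apply r (rowProdℚ m (suc k ∷ map suc (applyUpTo (f ∘ suc) n))) v (suc p) ≡ v (suc p)
        first p p<k = trans (split (suc p)) (trans (unchanged (isOdd (suc k ℕ.+ m)) refl) (below p (ℕ.m<n⇒m<1+n p<k)))
          where
          p≤r : p ≤ r
          p≤r = ℕ.<⇒≤ (ℕ.<-trans p<k k<r)
          unchanged : ∀ b → isOdd (suc k ℕ.+ m) ≡ b → apply r (Nℚ m (suc k)) w (suc p) ≡ w (suc p)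
          unchanged true odd = apply-N-odd-other m k w p p≤r (other p p<k) k<r odd
          unchanged false even = apply-N-even-other m k w p p≤r (ℕ.<⇒≢ p<k) k<r even
        second : apply r (rowProdℚ m (suc k ∷ map suc (applyUpTo (f ∘ suc) n))) v (suc k) ≡ vpart m v k
        second = trans (split (suc k)) (cases (isOdd (suc k ℕ.+ m)) refl)
          where
          cases : ∀ b → isOdd (suc k ℕ.+ m) ≡ b → apply r (Nℚ m (suc k)) w (suc k) ≡ vpart m v k
          cases true odd = trans (apply-N-odd-other m k w k (ℕ.<⇒≤ k<r) (ℕ.1+n≢n ∘ sym) k<r odd)
            (trans below-at (sym (vpart-even k (isOdd-suc⁻¹ (k ℕ.+ m) odd))))
          -- Here N_{k+1} is V_{k+1}; row k + 2, which it uses, still has its old value by parity.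
          cases false even = trans (apply-N-even m k w k<r even)
            (trans (cong₂ (λ y z → B (suc k) (suc m) * recip (B (suc k) m) * y + B k m * recip (B (suc k) m) * z)
                below-at (trans at (vpart-even (suc k) even)))
              (sym (vpart-odd k (isOdd-suc⁻¹ (k ℕ.+ m) even))))
        third : ∀ p → k < p → p ≤ r → apply r (rowProdℚ m (suc k ∷ map suc (applyUpTo (f ∘ suc) n))) v (suc p) ≡ upart m v p
        third p k<p p≤r = trans (split (suc p)) (cases (isOdd (suc k ℕ.+ m)) refl (p ℕ.≟ suc k))
          where
          1+k<p : p ≢ suc k → suc k < p
          1+k<p p≢1+k = ℕ.≤∧≢⇒< k<p (p≢1+k ∘ sym)
          cases : ∀ b → isOdd (suc k ℕ.+ m) ≡ b → Dec (p ≡ suc k) → apply r (Nℚ m (suc k)) w (suc p) ≡ upart m v p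
          -- Here N_{k+1} is U_{k+1}, exactly the factor that row k + 2 still lacked.
          cases true odd (yes refl) = trans (apply-N-odd m k w k<r odd)
            (trans (cong₂ (λ y z → B (2 ℕ.+ k) (suc m) * recip (B (suc k) m) * y + B (suc k) (suc m) * recip (B (suc k) m) * z) below-at at)
              (sym (upart-odd (suc k) odd)))
          cases true odd (no p≢1+k) = trans (apply-N-odd-other m k w p p≤r p≢1+k k<r odd) (above p (1+k<p p≢1+k) p≤r)
          cases false even (yes refl) = trans (apply-N-even-other m k w p p≤r ℕ.1+n≢n k<r even)
            (trans at (trans (vpart-even (suc k) even) (sym (upart-even (suc k) even))))
          cases false even (no p≢1+k) = trans (apply-N-even-other m k w p p≤r (λ p≡k → ℕ.<⇒≢ k<p (sym p≡k)) k<r even) (above p (1+k<p p≢1+k) p≤r)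

      RowProd-action : ∀ p → p ≤ r → apply r (rowProdℚ m (map suc (upTo r))) v (suc p) ≡ nextRow m v (suc p)
      RowProd-action p p≤r rewrite ≤⇒<ᵇ-false p≤r with p | p≤r | rowProd-action r 0 (λ i → i) (λ _ → refl) refl
      ... | zero | _ | _ , at , _ = trans at vpart-first
      ... | suc p′ | p′<r | _ , _ , above = above (suc p′) (s≤s z≤n) p′<r

    P-represented : ∀ t p q → _↝_ ρ (P r t p q) (x q t (suc (toℕ p)))
    P-represented zero p q = Id-represented p q
    P-represented (suc t) p q = ↝-resp (RowProd-action t (x q t) (x-left q t) (x-right q t) (toℕ p) (ℕ.≤-pred (Fin.toℕ<n p)))
      (↝-sumFin (suc r) (λ k → ↝-*F {v = rowProdℚ t (map suc (upTo r)) (suc (toℕ p)) (suc (toℕ k))} {w = x q t (suc (toℕ k))}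
        (rowProd-represented t (map suc (upTo r)) p k) (P-represented t k q)))

-- Functions given by polynomials off the coordinate hyperplanes

IsPolyFun : ∀ {r} → (Vec ℚ r → ℚ) → Set
IsPolyFun {r} F = Σ (Poly r) λ f → ∀ ρ → All (_≢ 0ℚ) ρ → ⟦ f ⟧ ρ ≡ F ρ

module _ {r : ℕ} where

  -- Agreement at points with nonzero coordinates is enough, so identities obtained by cancelling
  -- array values may be used.
  pf-cong : {F G : Vec ℚ r → ℚ} → (∀ ρ → All (_≢ 0ℚ) ρ → G ρ ≡ F ρ) → IsPolyFun F → IsPolyFun G
  pf-cong G≗F (f , f≗F) = f , λ ρ ρ≢0 → trans (f≗F ρ ρ≢0) (sym (G≗F ρ ρ≢0))

  pf-const : ∀ c → IsPolyFun {r} (λ _ → c)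
  pf-const c = κ c , λ _ _ → refl

  pf-+ : {F G : Vec ℚ r → ℚ} → IsPolyFun F → IsPolyFun G → IsPolyFun (λ ρ → F ρ + G ρ)
  pf-+ (f , f≗F) (g , g≗G) = f ⊞ g , λ ρ ρ≢0 → trans (⊞-hom f g ρ) (cong₂ _+_ (f≗F ρ ρ≢0) (g≗G ρ ρ≢0))

  pf-* : {F G : Vec ℚ r → ℚ} → IsPolyFun F → IsPolyFun G → IsPolyFun (λ ρ → F ρ * G ρ)
  pf-* (f , f≗F) (g , g≗G) = f ⊠ g , λ ρ ρ≢0 → trans (⊠-hom f g ρ) (cong₂ _*_ (f≗F ρ ρ≢0) (g≗G ρ ρ≢0))

  pf-neg : {F : Vec ℚ r → ℚ} → IsPolyFun F → IsPolyFun (λ ρ → - F ρ)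
  pf-neg (f , f≗F) = ⊟ f , λ ρ ρ≢0 → trans (⊟-hom f ρ) (cong -_ (f≗F ρ ρ≢0))

-- Polynomial expressions for the array and for the rows

module Polynomiality {r : ℕ} where

  open Values {r}

  module At (ρ : Vec ℚ r) (ρ≢0 : All (_≢ 0ℚ) ρ) where
    open Array r (B ρ) (λ _ → refl) (B-left ρ ρ≢0) (B-right ρ ρ≢0) (B≢0 ρ ρ≢0) (B-step ρ ρ≢0) public

  a-poly : ∀ k → IsPolyFun (λ ρ → B ρ k 1)
  a-poly k with edge r k
  ... | true = pf-const 1ℚ
  ... | false = Var r k , λ _ _ → refl

  -- The diagonal law moves towards level 0 or the edge 0, where the array is 1, and picks up only
  -- polynomial factors on the way.
  B-poly-above : ∀ t p → p ℕ.+ t ≤ suc r → IsPolyFun (λ ρ → B ρ p t)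
  B-poly-above zero p _ = pf-const 1ℚ
  B-poly-above (suc t) zero _ = pf-cong (λ ρ ρ≢0 → B-left ρ ρ≢0 (suc t)) (pf-const 1ℚ)
  B-poly-above (suc t) (suc p) (s≤s p+1+t≤r) = pf-cong (λ ρ ρ≢0 → At.B-diagonal ρ ρ≢0 t p p+t≤r)
    (pf-* (pf-* (pf-const (sgn t)) (a-poly (suc (p ℕ.+ t)))) (B-poly-above t p (ℕ.m≤n⇒m≤1+n p+t≤r)))
    where
    p+t≤r : p ℕ.+ t ≤ r
    p+t≤r = ℕ.<⇒≤ (subst (_≤ r) (ℕ.+-suc p t) p+1+t≤r)

  B-last-poly : ∀ w → w ≤ suc r → IsPolyFun (λ ρ → B ρ r w)
  B-last-poly zero _ = pf-const 1ℚ
  B-last-poly (suc t) (s≤s t≤r) = pf-cong (λ ρ ρ≢0 → At.B-last ρ ρ≢0 t (r ∸ t) (ℕ.m∸n+n≡m t≤r))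
    (pf-* (pf-const (sgn t)) (a-poly (r ∸ t)))

  -- Descending induction: `n` is the number of levels left to r + 1, where the array is 1 or -1.
  -- The condition `r ≤ p + t` makes the index w = p + t - r of the coefficient `B r w` a natural
  -- number.
  B-poly-below : ∀ n t p → t ℕ.+ n ≡ suc r → p ≤ suc r → r ≤ p ℕ.+ t → IsPolyFun (λ ρ → B ρ p t)
  B-poly-below zero t p t+0≡1+r p≤1+r _ with trans (sym (ℕ.+-identityʳ t)) t+0≡1+r | even-or-odd (suc r ∸ p)
  ... | refl | inj₁ even = pf-cong (λ ρ ρ≢0 → At.B-bottom-even ρ ρ≢0 p (suc r ∸ p) (ℕ.m+[n∸m]≡n p≤1+r) even) (pf-const 1ℚ)
  ... | refl | inj₂ odd = pf-cong (λ ρ ρ≢0 → At.B-bottom-odd ρ ρ≢0 p (suc r ∸ p) (ℕ.m+[n∸m]≡n p≤1+r) odd) (pf-const (sgn r))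
  B-poly-below (suc n) t p t+1+n≡1+r p≤1+r r≤p+t with ℕ.m≤n⇒m<n∨m≡n p≤1+r
  ... | inj₂ refl = pf-cong (λ ρ ρ≢0 → B-right ρ ρ≢0 t) (pf-const 1ℚ)
  ... | inj₁ (s≤s p≤r) = pf-cong
    (λ ρ ρ≢0 → subst (λ s → B ρ p s ≡ sgn v * B ρ r w * B ρ (suc p) (suc s)) v+w≡t (At.B-diagonal-right ρ ρ≢0 v p w (ℕ.m+[n∸m]≡n p≤r)))
    (pf-* (pf-* (pf-const (sgn v)) (B-last-poly w (ℕ.≤-trans w≤t t≤1+r)))
      (B-poly-below n (suc t) (suc p) (trans (sym (ℕ.+-suc t n)) t+1+n≡1+r) (s≤s p≤r) (ℕ.m≤n⇒m≤1+n (ℕ.≤-trans r≤p+t (ℕ.+-monoʳ-≤ p (ℕ.n≤1+n t))))))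
    where
    v = r ∸ p
    w = t ∸ v
    v≤t : v ≤ t
    v≤t = ℕ.m≤n+o⇒m∸n≤o r p r≤p+t
    v+w≡t : v ℕ.+ w ≡ t
    v+w≡t = ℕ.m+[n∸m]≡n v≤t
    w≤t : w ≤ t
    w≤t = ℕ.m∸n≤m t v
    t≤1+r : t ≤ suc r
    t≤1+r = subst (t ≤_) t+1+n≡1+r (ℕ.m≤m+n t (suc n))

  module _ (q : Fin (suc r)) where

    module RowsAt (ρ : Vec ℚ r) (ρ≢0 : All (_≢ 0ℚ) ρ) where
      open At.Rows ρ ρ≢0 (x ρ q) (x-left ρ ρ≢0 q) (x-right ρ ρ≢0 q) (x-same ρ ρ≢0 q) (x-step ρ ρ≢0 q) public

    x-left-poly : ∀ t → IsPolyFun (λ ρ → x ρ q t 0)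
    x-left-poly t = pf-cong (λ ρ ρ≢0 → x-left ρ ρ≢0 q t) (pf-const 0ℚ)

    x₀-poly : ∀ p → IsPolyFun (λ ρ → x ρ q 0 p)
    x₀-poly p = pf-const (δ p (suc (toℕ q)))

    -- The parity singles out the entries governed by `x-diagonal`. It is preserved along a
    -- diagonal, so the recursion stays among them until it reaches the initial column or the zero
    -- row.
    x-poly-above : ∀ t p → p ℕ.+ t ≤ suc r → isOdd (p ℕ.+ t) ≡ false → IsPolyFun (λ ρ → x ρ q t (suc p))
    x-poly-above zero p _ _ = x₀-poly (suc p)
    x-poly-above (suc t) p p+1+t≤1+r even = pf-cong (λ ρ ρ≢0 → RowsAt.x-diagonal ρ ρ≢0 t p p+t≤r odd)
      (pf-+ (pf-* (pf-* (pf-const (sgn t)) (a-poly (suc (p ℕ.+ t)))) (previous p p+t≤r odd))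
        (pf-* (B-poly-above (suc t) p p+1+t≤1+r)
          (pf-+ (pf-* (a-poly (suc (p ℕ.+ t))) (x₀-poly (suc (p ℕ.+ t)))) (x₀-poly (2 ℕ.+ (p ℕ.+ t))))))
      where
      p+t≤r : p ℕ.+ t ≤ r
      p+t≤r = ℕ.≤-pred (subst (_≤ suc r) (ℕ.+-suc p t) p+1+t≤1+r)
      odd : isOdd (p ℕ.+ t) ≡ true
      odd = isOdd-suc⁻¹ (p ℕ.+ t) (trans (cong isOdd (sym (ℕ.+-suc p t))) even)
      previous : ∀ p → p ℕ.+ t ≤ r → isOdd (p ℕ.+ t) ≡ true → IsPolyFun (λ ρ → x ρ q t p)
      previous zero _ _ = x-left-poly t
      previous (suc p) p+t<r odd = x-poly-above t p (ℕ.m≤n⇒m≤1+n (ℕ.<⇒≤ p+t<r)) (isOdd-suc⁻¹ (p ℕ.+ t) odd)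

    -- The last row either has just been rewritten, and then it is some `d u`, or it is copied from
    -- the level before.
    x-last-poly : ∀ t → t ≤ suc r → IsPolyFun (λ ρ → x ρ q t (suc r))
    x-last-poly zero _ = x₀-poly (suc r)
    x-last-poly (suc t) (s≤s t≤r) with even-or-odd (r ℕ.+ t)
    ... | inj₁ even = pf-cong (λ ρ ρ≢0 → x-same ρ ρ≢0 q t r ℕ.≤-refl even) (x-last-poly t (ℕ.m≤n⇒m≤1+n t≤r))
    ... | inj₂ r+t-odd = pf-cong (λ ρ ρ≢0 → RowsAt.x-last ρ ρ≢0 t u u+t≡r odd)
      (pf-+ (x₀-poly u) (pf-* (a-poly u) (x₀-poly (suc u))))
      where
      u = r ∸ t
      u+t≡r : u ℕ.+ t ≡ r
      u+t≡r = ℕ.m∸n+n≡m t≤r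
      odd : isOdd u ≡ true
      odd = trans (sym (isOdd-+2* u t)) (trans (cong (λ n → isOdd (n ℕ.+ t)) u+t≡r) r+t-odd)

    -- Descending induction on the number `n` of levels left to r + 1. A diagonal followed downwards
    -- ends on the known bottom level or in the last row, whose entries are polynomial on every
    -- level; the parity is that of `x-diagonal-right`.
    x-poly-below : ∀ n t p → t ℕ.+ n ≡ suc r → p ≤ suc r → r ≤ p ℕ.+ t → isOdd (p ℕ.+ t) ≡ true → IsPolyFun (λ ρ → x ρ q t p)
    x-poly-below n t zero _ _ _ _ = x-left-poly t
    x-poly-below zero t (suc p) t+0≡1+r (s≤s p≤r) _ odd with trans (sym (ℕ.+-identityʳ t)) t+0≡1+r
    ... | refl = pf-cong (λ ρ ρ≢0 → RowsAt.x-bottom ρ ρ≢0 w p p+w≡r w-odd) (pf-* (pf-const (- sgn r)) (x₀-poly (suc w)))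
      where
      w = r ∸ p
      p+w≡r : p ℕ.+ w ≡ r
      p+w≡r = ℕ.m+[n∸m]≡n p≤r
      w-odd : isOdd w ≡ true
      w-odd = trans (sym (isOdd-+2* w p)) (trans (cong isOdd (trans (cong (ℕ._+ p) (trans (ℕ.+-comm w p) p+w≡r)) (ℕ.+-comm r p)))
        (isOdd-2+⁻¹ (p ℕ.+ r) (trans (cong (isOdd ∘ suc) (sym (ℕ.+-suc p r))) odd)))
    x-poly-below (suc n) t p@(suc _) t+1+n≡1+r p≤1+r r≤p+t odd with ℕ.m≤n⇒m<n∨m≡n p≤1+r
    ... | inj₂ refl = x-last-poly t (subst (t ≤_) t+1+n≡1+r (ℕ.m≤m+n t (suc n)))
    ... | inj₁ (s≤s p≤r) = pf-cong
      (λ ρ ρ≢0 → subst (λ s → x ρ q s p ≡ sgn v * B ρ r w * x ρ q (suc s) (suc p) - sgn v * B ρ p (suc s) * x ρ q w (suc r)) v+w≡t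
        (RowsAt.x-diagonal-right ρ ρ≢0 v p w (ℕ.m+[n∸m]≡n p≤r) r+w-odd))
      (pf-+
        (pf-* (pf-* (pf-const (sgn v)) (B-last-poly w w≤1+r)) (x-poly-below n (suc t) (suc p) 1+t+n≡1+r (s≤s p≤r) r≤1+p+1+t 1+p+1+t-odd))
        (pf-neg (pf-* (pf-* (pf-const (sgn v)) (B-poly-below n (suc t) p 1+t+n≡1+r p≤1+r r≤p+1+t)) (x-last-poly w w≤1+r))))
      where
      v = r ∸ p
      w = t ∸ v
      v+w≡t : v ℕ.+ w ≡ t
      v+w≡t = ℕ.m+[n∸m]≡n (ℕ.m≤n+o⇒m∸n≤o r p r≤p+t)
      w≤1+r : w ≤ suc r
      w≤1+r = ℕ.≤-trans (ℕ.m∸n≤m t v) (subst (t ≤_) t+1+n≡1+r (ℕ.m≤m+n t (suc n)))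
      r+w-odd : isOdd (r ℕ.+ w) ≡ true
      r+w-odd = trans (cong isOdd (trans (cong (ℕ._+ w) (sym (ℕ.m+[n∸m]≡n p≤r))) (trans (ℕ.+-assoc p v w) (cong (p ℕ.+_) v+w≡t)))) odd
      1+t+n≡1+r : suc t ℕ.+ n ≡ suc r
      1+t+n≡1+r = trans (sym (ℕ.+-suc t n)) t+1+n≡1+r
      r≤p+1+t : r ≤ p ℕ.+ suc t
      r≤p+1+t = ℕ.≤-trans r≤p+t (ℕ.+-monoʳ-≤ p (ℕ.n≤1+n t))
      r≤1+p+1+t : r ≤ suc p ℕ.+ suc t
      r≤1+p+1+t = ℕ.m≤n⇒m≤1+n r≤p+1+t
      1+p+1+t-odd : isOdd (suc p ℕ.+ suc t) ≡ true
      1+p+1+t-odd = trans (cong (isOdd ∘ suc) (ℕ.+-suc p t)) (trans (isOdd-suc (suc (p ℕ.+ t))) (cong not (trans (isOdd-suc (p ℕ.+ t)) (cong not odd))))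

    x-poly-even : ∀ j p → j ≤ suc r → p ≤ r → isOdd (p ℕ.+ j) ≡ false → IsPolyFun (λ ρ → x ρ q j (suc p))
    x-poly-even j p j≤1+r p≤r even with ℕ.≤-total (p ℕ.+ j) (suc r)
    ... | inj₁ above = x-poly-above j p above even
    ... | inj₂ below = x-poly-below (suc r ∸ j) j (suc p) (ℕ.m+[n∸m]≡n j≤1+r) (s≤s p≤r)
      (ℕ.m≤n⇒m≤1+n (ℕ.<⇒≤ below)) (trans (isOdd-suc (p ℕ.+ j)) (cong not even))

    -- An entry of the wrong parity was not touched in the last step, so it equals the one a level
    -- earlier, whose parity is right.
    x-poly : ∀ j p → j ≤ suc r → p ≤ r → IsPolyFun (λ ρ → x ρ q j (suc p))
    x-poly zero p _ _ = x₀-poly (suc p)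
    x-poly (suc j) p j<1+r p≤r with even-or-odd (p ℕ.+ j)
    ... | inj₁ even = pf-cong (λ ρ ρ≢0 → x-same ρ ρ≢0 q j p p≤r even) (x-poly-even j p (ℕ.<⇒≤ j<1+r) p≤r even)
    ... | inj₂ odd = x-poly-even (suc j) p j<1+r p≤r
      (trans (cong isOdd (ℕ.+-suc p j)) (trans (isOdd-suc (p ℕ.+ j)) (cong not odd)))

-- From values back to formal fractions

ones-nonzero : ∀ r → All (_≢ 0ℚ) (replicate r 1ℚ)
ones-nonzero zero = []
ones-nonzero (suc r) = 1≢0 ∷ ones-nonzero r

theorem5p14 : (r : ℕ) → 1 ≤ r → (j : ℕ) → j ≤ suc r →
    (p q : Fin (suc r)) → IsPolynomial r (P r j p q)
theorem5p14 r _ j j≤1+r p q with Polynomiality.x-poly q j (toℕ p) j≤1+r (ℕ.≤-pred (Fin.toℕ<n p))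
... | f , f≗x = denominator-nonzero , f , ⟦⟧-injective n (f ⊠ d) agree
  where
  n = proj₁ (P r j p q)
  d = proj₂ (P r j p q)
  -- The point (1, ..., 1) serves as a witness: a zero polynomial would vanish there, and the
  -- denominator does not.
  denominator-nonzero : ¬ Zero d
  denominator-nonzero z = _↝_.denominator≢0 (Values.P-represented (replicate r 1ℚ) (ones-nonzero r) j p q)
    (sym (zero-hom d z (replicate r 1ℚ)))
  agree : ∀ ρ → All (_≢ 0ℚ) ρ → ⟦ n ⟧ ρ ≡ ⟦ f ⊠ d ⟧ ρ
  agree ρ ρ≢0 = trans (_↝_.numerator≡ (Values.P-represented ρ ρ≢0 j p q))
    (trans (cong (_* ⟦ d ⟧ ρ) (sym (f≗x ρ ρ≢0))) (sym (⊠-hom f d ρ)))
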